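{- $$\sum_{m\ge0}\ \sum_{\lambda\vdash m}\ \sum_{\vec m,\vec p}S_\lambda^{\vec m}(\mathbf x^{(1)},\dots,\mathbf x^{(n)})\,S_\lambda^{\vec p}(\mathbf y^{(1)},\dots,\mathbf y^{(n)})=\prod_{i,j\ge1}\frac{1}{1-\sum_{k,l=1}^n x_i^{(k)}y_j^{(l)}},$$ where $\vec m,\vec p$ range over vectors of $n$ nonnegative integers whose entries sum to $m$.
   Context: Take commuting variables $x^{(k)}_i$ and $y^{(k)}_i$ ($i\ge1$, $1\le k\le n$). Let $A=\{i^{(k)}:i\ge1,1\le k\le n\}$ be partially ordered by $i^{(k)}<j^{(l)}$ iff $i<j$. A dotted Young tableau of shape $\lambda$ and multidegree $\vec m=[m_1,\dots,m_n]$ is a filling of the Young diagram of $\lambda$ with elements of $A$, rows weakly increasing and columns strictly increasing in this order, with exactly $m_k$ entries of the form $i^{(k)}$ for each $k$. $S_\lambda^{\vec m}(\mathbf x^{(1)},\dots,\mathbf x^{(n)})=\sum_T\prod_{i^{(j)}\in T}x_i^{(j)}$ over all such tableaux $T$ (product over entries with multiplicity), and $S_\lambda^{\vec p}(\mathbf y^{(1)},\dots,\mathbf y^{(n)})$ is defined in the same way with $y$ in place of $x$. -}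

module Defs where

open import Data.Nat using (ℕ; zero; suc; _+_; _*_; _∸_; _<_; _≥_; _<?_; _≥?_)
import Data.Nat.Properties as ℕP
open import Data.Fin using (Fin; toℕ)
import Data.Fin.Properties as FinP
open import Data.Nat.ListAction using (sum)
open import Data.List using (List; []; _∷_; length; map; concat; concatMap; filter; upTo; allFin; cartesianProduct)
import Data.List.Properties as ListP
open import Data.List.Relation.Unary.Linked using (Linked; linked?)
open import Data.List.Relation.Unary.All using (All; all?)
open import Data.Vec using (Vec; lookup) renaming ([] to []ᵥ; _∷_ to _∷ᵥ_)
open import Data.Product using (_×_; _,_; proj₁; proj₂)
import Data.Product.Properties as ProdP
open import Data.Unit using (⊤; tt)
open import Data.Empty using (⊥)
open import Relation.Binary.PropositionalEquality using (_≡_)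
open import Relation.Binary.Definitions using (DecidableEquality)
open import Relation.Nullary using (Dec; yes; no; ¬_; ¬?; _×-dec_)

wordsOver : {A : Set} → List A → ℕ → List (List A)
wordsOver xs zero    = [] ∷ []
wordsOver xs (suc ℓ) = concatMap (λ a → map (a ∷_) (wordsOver xs ℓ)) xs

wordsUpTo : {A : Set} → List A → ℕ → List (List A)
wordsUpTo xs D = concatMap (wordsOver xs) (upTo (suc D))

allVecs : {A : Set} → List A → (k : ℕ) → List (Vec A k)
allVecs xs zero    = []ᵥ ∷ []
allVecs xs (suc k) = concatMap (λ a → map (a ∷ᵥ_) (allVecs xs k)) xs

countP : {A : Set} {P : A → Set} → ((a : A) → Dec (P a)) → List A → ℕ
countP P? xs = length (filter P? xs)

ΣFin : (N : ℕ) → (Fin N → ℕ) → ℕ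
ΣFin N f = sum (map f (allFin N))

IsPartitionOf : ℕ → List ℕ → Set
IsPartitionOf m λ′ = Linked _≥_ λ′ × All (λ p → 0 < p) λ′ × sum λ′ ≡ m

isPartitionOf? : (m : ℕ) (λ′ : List ℕ) → Dec (IsPartitionOf m λ′)
isPartitionOf? m λ′ =
  linked? ℕP._≥?_ λ′ ×-dec (all? (λ p → 0 <? p) λ′ ×-dec (sum λ′ ℕP.≟ m))

-- the list of all partitions of m (a partition of m has at most m parts,
-- each at most m)
partitions : ℕ → List (List ℕ)
partitions m = filter (isPartitionOf? m) (wordsUpTo (upTo (suc m)) m)

weakComps : (n m : ℕ) → List (Vec ℕ n)
weakComps zero    zero    = []ᵥ ∷ []
weakComps zero    (suc m) = []
weakComps (suc n) m = concatMap (λ j → map (j ∷ᵥ_) (weakComps n (m ∸ j))) (upTo (suc m))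

-- The alphabet A, restricted to lower indices 1..N:
-- the letter (i , k) with i : Fin N, k : Fin n stands for (toℕ i + 1)^(toℕ k + 1).

Letter : ℕ → ℕ → Set
Letter N n = Fin N × Fin n

letters : (N n : ℕ) → List (Letter N n)
letters N n = cartesianProduct (allFin N) (allFin n)

_≟L_ : {N n : ℕ} → DecidableEquality (Letter N n)
_≟L_ = ProdP.≡-dec FinP._≟_ FinP._≟_

_<A_ : {N n : ℕ} → Letter N n → Letter N n → Set
a <A b = toℕ (proj₁ a) < toℕ (proj₁ b)

_<A?_ : {N n : ℕ} (a b : Letter N n) → Dec (a <A b)
a <A? b = toℕ (proj₁ a) <? toℕ (proj₁ b)

-- "weakly increasing" along rows: a is followed by b only if b is not
-- strictly smaller than a (so i^(k) and i^(l) may be adjacent in either order)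
_≤A_ : {N n : ℕ} → Letter N n → Letter N n → Set
a ≤A b = ¬ (b <A a)

_≤A?_ : {N n : ℕ} (a b : Letter N n) → Dec (a ≤A b)
a ≤A? b = ¬? (b <A? a)

-- Fillings and dotted Young tableaux (English notation, list of rows)

Filling : ℕ → ℕ → Set
Filling N n = List (List (Letter N n))

ColStrict : {N n : ℕ} → List (Letter N n) → List (Letter N n) → Set
ColStrict _        []       = ⊤
ColStrict []       (b ∷ bs) = ⊥
ColStrict (a ∷ as) (b ∷ bs) = (a <A b) × ColStrict as bs

colStrict? : {N n : ℕ} (r s : List (Letter N n)) → Dec (ColStrict r s)
colStrict? _        []       = yes tt
colStrict? []       (b ∷ bs) = no (λ ())
colStrict? (a ∷ as) (b ∷ bs) = (a <A? b) ×-dec colStrict? as bs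

entries : {N n : ℕ} → Filling N n → List (Letter N n)
entries = concat

colourCount : {N n : ℕ} → Fin n → Filling N n → ℕ
colourCount k T = countP (λ a → proj₂ a FinP.≟ k) (entries T)

letterCount : {N n : ℕ} → Letter N n → Filling N n → ℕ
letterCount a T = countP (λ b → b ≟L a) (entries T)

-- T is a dotted Young tableau of shape λ′ and multidegree v, whose monomial
-- ∏_{i^(k) ∈ T} x_i^(k) equals ∏ (x_i^(k))^(α i k)
IsDottedTableau : {N n : ℕ} → List ℕ → Vec ℕ n → (Fin N → Fin n → ℕ) → Filling N n → Set
IsDottedTableau {N} {n} λ′ v α T =
  (map length T ≡ λ′)
  × All (Linked _≤A_) T
  × Linked ColStrict T
  × ((k : Fin n) → colourCount k T ≡ lookup v k)
  × ((i : Fin N) (k : Fin n) → letterCount (i , k) T ≡ α i k)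

isDottedTableau? : {N n : ℕ} (λ′ : List ℕ) (v : Vec ℕ n) (α : Fin N → Fin n → ℕ)
                   (T : Filling N n) → Dec (IsDottedTableau λ′ v α T)
isDottedTableau? λ′ v α T =
  ListP.≡-dec ℕP._≟_ (map length T) λ′
  ×-dec (all? (linked? _≤A?_) T
  ×-dec (linked? colStrict? T
  ×-dec (FinP.all? (λ k → colourCount k T ℕP.≟ lookup v k)
  ×-dec FinP.all? (λ i → FinP.all? (λ k → letterCount (i , k) T ℕP.≟ α i k)))))

fillings : (N n : ℕ) → List ℕ → List (Filling N n)
fillings N n []        = [] ∷ []
fillings N n (r ∷ λ′) =
  concatMap (λ row → map (row ∷_) (fillings N n λ′)) (wordsOver (letters N n) r)

-- coefficient of the monomial x^α in S_λ^v(x^(1),…,x^(n)):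
-- the number of dotted Young tableaux of shape λ′, multidegree v and content α
tabCoeff : {N n : ℕ} → List ℕ → Vec ℕ n → (Fin N → Fin n → ℕ) → ℕ
tabCoeff {N} {n} λ′ v α = countP (isDottedTableau? λ′ v α) (fillings N n λ′)

degree : {N n : ℕ} → (Fin N → Fin n → ℕ) → ℕ
degree {N} {n} α = ΣFin N (λ i → ΣFin n (λ k → α i k))

-- Left-hand side coefficient of x^α y^β:
--   Σ_{λ ⊢ m} Σ_{m⃗, p⃗} [x^α] S_λ^{m⃗}(x) · [y^β] S_λ^{p⃗}(y)
-- with m = degree α (the only m for which a λ ⊢ m has tableaux of content α).

lhsCoeff : (N n : ℕ) → (Fin N → Fin n → ℕ) → (Fin N → Fin n → ℕ) → ℕ
lhsCoeff N n α β =
  sum (map (λ λ′ →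
    sum (map (λ v →
      sum (map (λ w → tabCoeff λ′ v α * tabCoeff λ′ w β)
               (weakComps n (degree α))))
             (weakComps n (degree α))))
          (partitions (degree α)))

-- Right-hand side coefficient of x^α y^β in
--   ∏_{i,j} 1 / (1 - Σ_{k,l} x_i^(k) y_j^(l))
--   = ∏_{i,j} Σ_{d ≥ 0} (Σ_{k,l} x_i^(k) y_j^(l))^d
--   = Σ over families (w_{ij}) of words over {1..n}×{1..n} of ∏_{i,j} ∏_{(k,l) ∈ w_{ij}} x_i^(k) y_j^(l).
-- A family is a matrix W : Vec (Vec (List (Fin n × Fin n)) N) N (W i j = w_{ij}).

WordFamily : ℕ → ℕ → Set
WordFamily N n = Vec (Vec (List (Fin n × Fin n)) N) N

entry : {N n : ℕ} → WordFamily N n → Fin N → Fin N → List (Fin n × Fin n)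
entry W i j = lookup (lookup W i) j

xExp : {N n : ℕ} → WordFamily N n → Fin N → Fin n → ℕ
xExp {N} W i k = ΣFin N (λ j → countP (λ c → proj₁ c FinP.≟ k) (entry W i j))

yExp : {N n : ℕ} → WordFamily N n → Fin N → Fin n → ℕ
yExp {N} W j l = ΣFin N (λ i → countP (λ c → proj₂ c FinP.≟ l) (entry W i j))

HasMonomial : {N n : ℕ} → (Fin N → Fin n → ℕ) → (Fin N → Fin n → ℕ) → WordFamily N n → Set
HasMonomial {N} {n} α β W =
  ((i : Fin N) (k : Fin n) → xExp W i k ≡ α i k)
  × ((j : Fin N) (l : Fin n) → yExp W j l ≡ β j l)

hasMonomial? : {N n : ℕ} (α β : Fin N → Fin n → ℕ) (W : WordFamily N n) → Dec (HasMonomial α β W)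
hasMonomial? α β W =
  FinP.all? (λ i → FinP.all? (λ k → xExp W i k ℕP.≟ α i k))
  ×-dec FinP.all? (λ j → FinP.all? (λ l → yExp W j l ℕP.≟ β j l))

wordFamilies : (N n D : ℕ) → List (WordFamily N n)
wordFamilies N n D =
  allVecs (allVecs (wordsUpTo (cartesianProduct (allFin n) (allFin n)) D) N) N

-- every family with monomial x^α y^β has all words of length ≤ degree α
rhsCoeff : (N n : ℕ) → (Fin N → Fin n → ℕ) → (Fin N → Fin n → ℕ) → ℕ
rhsCoeff N n α β = countP (hasMonomial? α β) (wordFamilies N n (degree α))

{-# OPTIONS --safe #-}
module Submission where

-- Removing the strips of the letters one index at a time turns a dotted tableau
-- into a chain of partitions ∅ ≺ … ≺ λ (a Gelfand–Tsetlin pattern) in which each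
-- horizontal strip carries the word of the colours of its cells.  Two horizontal
-- strips λ/μ and λ/ν correspond to strips μ/ρ and ν/ρ together with an integer
-- c ≥ 0 (Fomin's local rule), where |λ/μ| = |ν/ρ| + c and |λ/ν| = |μ/ρ| + c.
-- Cutting the first c colours off both words and zipping them yields one word of
-- pairs.  Iterating over the growth diagram identifies pairs of tableaux of equal
-- shape with matrices of words of pairs, and every colour is kept on the way, so
-- the monomials on the two sides agree.

open import Defs
open import Data.Bool using (true; false)
open import Data.Empty using (⊥-elim)
open import Data.Fin using (Fin; zero; suc; toℕ; opposite)
open import Data.Fin.Properties using (_≟_; opposite-prop; opposite-involutive; toℕ<n)
import Data.Fin.Properties as Fin
open import Data.List using (List; []; _∷_; _++_; map; length; take; drop; concatMap; filter; upTo; allFin; cartesianProduct)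
open import Data.List.Membership.Propositional using (_∈_; find; lose)
open import Data.List.Membership.Propositional.Properties
open import Data.List.Membership.Propositional.Properties.WithK using (unique∧set⇒bag)
open import Data.List.Properties hiding (≡-dec; tabulate-cong; sum-++)
open import Data.List.Relation.Binary.BagAndSetEquality using (∼bag⇒↭)
open import Data.List.Relation.Binary.Permutation.Propositional using (_↭_)
open import Data.List.Relation.Binary.Permutation.Propositional.Properties using (↭-length) renaming (map⁺ to ↭-map⁺)
open import Data.List.Relation.Unary.All as All using (All; []; _∷_)
import Data.List.Relation.Unary.All.Properties as All
open import Data.List.Relation.Unary.AllPairs using (AllPairs; []; _∷_)
import Data.List.Relation.Unary.AllPairs.Properties as AllPairs
open import Data.List.Relation.Unary.Any using (here)
open import Data.List.Relation.Unary.Linked using (Linked; []; [-]; _∷_)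
open import Data.List.Relation.Unary.Linked.Properties using (AllPairs⇒Linked; Linked⇒AllPairs)
open import Data.List.Relation.Unary.Unique.Propositional using (Unique)
import Data.List.Relation.Unary.Unique.Propositional.Properties as Unique
open import Data.Nat using (ℕ; zero; suc; _+_; _*_; _∸_; _⊔_; _⊓_; _≤_; _<_; _≥_; z≤n; s≤s)
open import Data.Nat.ListAction using (sum)
open import Data.Nat.ListAction.Properties using (sum-↭)
open import Data.Nat.Properties hiding (_≟_)
open import Data.Nat.Solver using (module +-*-Solver)
open import Data.Product using (_×_; _,_; proj₁; proj₂; ∃-syntax)
open import Data.Product.Properties using (,-injective)
open import Data.Unit using (⊤; tt)
open import Data.Vec using (Vec; []; _∷_; lookup; replicate; tabulate)
open import Data.Vec.Membership.Propositional using () renaming (_∈_ to _∈ᵥ_)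
open import Data.Vec.Membership.Propositional.Properties using () renaming (∈-lookup to ∈ᵥ-lookup; ∈-tabulate⁺ to ∈ᵥ-tabulate⁺)
open import Data.Vec.Properties using (lookup∘tabulate; tabulate∘lookup; tabulate-cong) renaming (∷-injective to ∷ᵥ-injective)
import Data.Vec.Relation.Unary.All as Allᵥ
import Data.Vec.Relation.Unary.All.Properties as Allᵥ
open import Data.Vec.Relation.Unary.AllPairs using ([]; _∷_) renaming (AllPairs to AllPairsᵥ)
open import Data.Vec.Relation.Unary.Any using (here; there)
open import Function using (_∘_; mk⇔)
open import Relation.Binary.PropositionalEquality
open import Relation.Nullary using (Dec; does; yes; no; ¬_)

-- The local rule

-- Letters with the same index may stand next to each other in either order, so the cells of a
-- horizontal strip can be coloured freely: colours enter only through a word as long as the strip.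
-- The right-hand side has the same freedom, since 1/(1 - Σ) expands into arbitrary words of pairs.
-- Hence ordinary RSK for the shapes, with an entry c replaced by a word of length c, is enough.
-- After c colours are cut off from λ/ν and from λ/μ, what remains has exactly the length needed for
-- μ/ρ and ν/ρ, so it does not matter on which cells the colours sat. Taking the first c is a
-- convention that makes the cut invertible.
--
-- The local rule is a recursion on rows: the surplus min(μᵣ, νᵣ) - ρᵣ of one row plays the part of
-- c for the rows below. Partitions are lists without zero parts; this makes them unique, but each
-- construction must then split off the case of a vanishing part.
--
-- Both coefficients are lengths of filtered lists, so the bijection is used as an injective map
-- between lists without repetitions whose image is the whole target.

hd : List ℕ → ℕ
hd []      = 0
hd (x ∷ _) = x

tl : List ℕ → List ℕ
tl []       = []
tl (_ ∷ xs) = xs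

-- μ ≺ ν; the relation itself forces both lists to be partitions without zero parts.
data HorizontalStrip : List ℕ → List ℕ → Set where
  []   : HorizontalStrip [] []
  last : ∀ {l} → 0 < l → HorizontalStrip [] (l ∷ [])
  cons : ∀ {m l μ ν} → 0 < m → m ≤ l → hd ν ≤ m →
         HorizontalStrip μ ν → HorizontalStrip (m ∷ μ) (l ∷ ν)

strip-sum : ∀ {μ ν} → HorizontalStrip μ ν → sum μ ≤ sum ν
strip-sum []               = z≤n
strip-sum (last _)         = z≤n
strip-sum (cons _ m≤l _ h) = +-mono-≤ m≤l (strip-sum h)

strip-upper-[] : ∀ {μ ν} → HorizontalStrip μ ν → hd ν ≡ 0 → μ ≡ [] × ν ≡ []
strip-upper-[] []                         _    = refl , refl
strip-upper-[] (last (s≤s _))             ()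
strip-upper-[] (cons (s≤s _) (s≤s _) _ _) ()

strip-lower-[] : ∀ {μ ν} → HorizontalStrip μ ν → hd μ ≡ 0 → μ ≡ []
strip-lower-[] []                   _ = refl
strip-lower-[] (last _)             _ = refl
strip-lower-[] (cons (s≤s _) _ _ _) ()

-- A missing part of ρ counts as 0, so both forms of a strip that ends in a non-empty partition are
-- peeled alike.
strip-tl : ∀ {ρ m μ} → HorizontalStrip ρ (m ∷ μ) → HorizontalStrip (tl ρ) μ × hd ρ ≤ m
strip-tl (last _)         = [] , z≤n
strip-tl (cons _ r≤m _ h) = h , r≤m

-- A zero surplus must give the empty partition, not a part 0.
single : ℕ → List ℕ
single zero      = []
single l@(suc _) = l ∷ []

hd-single : ∀ c → hd (single c) ≡ c
hd-single zero    = refl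
hd-single (suc _) = refl

sum-single : ∀ c → sum (single c) ≡ c
sum-single zero    = refl
sum-single (suc c) = +-identityʳ (suc c)

strip-single : ∀ c → HorizontalStrip [] (single c)
strip-single zero    = []
strip-single (suc _) = last (s≤s z≤n)

single-positive : ∀ {c} → 0 < c → single c ≡ c ∷ []
single-positive (s≤s _) = refl

-- Fomin's local rule on Gelfand–Tsetlin patterns: for ρ ≺ μ and ρ ≺ ν,
-- λ₁ = max(μ₁, ν₁) + c and λᵣ₊₁ = max(μᵣ₊₁, νᵣ₊₁) + min(μᵣ, νᵣ) − ρᵣ.
glue : ℕ → List ℕ → List ℕ → List ℕ → List ℕ
glue c []      []      ρ = single c
glue c (m ∷ μ) []      ρ = (m + c) ∷ μ
glue c []      (n ∷ ν) ρ = (n + c) ∷ ν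
glue c (m ∷ μ) (n ∷ ν) ρ = (m ⊔ n + c) ∷ glue (m ⊓ n ∸ hd ρ) μ ν (tl ρ)

glue-comm : ∀ c μ ν ρ → glue c μ ν ρ ≡ glue c ν μ ρ
glue-comm c []      []      ρ = refl
glue-comm c []      (n ∷ ν) ρ = refl
glue-comm c (m ∷ μ) []      ρ = refl
glue-comm c (m ∷ μ) (n ∷ ν) ρ
  rewrite ⊔-comm m n | ⊓-comm m n = cong (_ ∷_) (glue-comm _ μ ν (tl ρ))

hd-glue : ∀ c μ ν ρ → hd (glue c μ ν ρ) ≡ hd μ ⊔ hd ν + c
hd-glue c []      []      ρ = hd-single c
hd-glue c []      (n ∷ ν) ρ = refl
hd-glue c (m ∷ μ) []      ρ = cong (_+ c) (sym (⊔-identityʳ m))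
hd-glue c (m ∷ μ) (n ∷ ν) ρ = refl

-- Both μᵣ₊₁ and νᵣ₊₁ are at most ρᵣ, so after the surplus min(μᵣ, νᵣ) - ρᵣ is added, row r + 1
-- still stays within min(μᵣ, νᵣ). This is the interlacing with the row above.
glue-stripˡ : ∀ c {μ ν ρ} → HorizontalStrip ρ μ → HorizontalStrip ρ ν →
              HorizontalStrip μ (glue c μ ν ρ)
glue-stripˡ c [] [] = strip-single c
glue-stripˡ c [] (last 0<n) = last (≤-trans 0<n (m≤m+n _ c))
glue-stripˡ c (last 0<m) [] = cons 0<m (m≤m+n _ c) z≤n []
glue-stripˡ c {m ∷ []} {n ∷ []} (last 0<m) (last 0<n) =
  cons 0<m (≤-trans (m≤m⊔n m n) (m≤m+n _ c))
       (≤-trans (≤-reflexive (hd-single (m ⊓ n))) (m⊓n≤m m n)) (strip-single _)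
glue-stripˡ c {m ∷ μ} {n ∷ ν} {r ∷ ρ} (cons 0<r r≤m μ≤r h) (cons _ r≤n ν≤r k) =
  cons (≤-trans 0<r r≤m) (≤-trans (m≤m⊔n m n) (m≤m+n _ c)) bound
       (glue-stripˡ (m ⊓ n ∸ r) h k)
  where
  open ≤-Reasoning
  bound : hd (glue (m ⊓ n ∸ r) μ ν ρ) ≤ m
  bound = begin
    hd (glue (m ⊓ n ∸ r) μ ν ρ)  ≡⟨ hd-glue (m ⊓ n ∸ r) μ ν ρ ⟩
    hd μ ⊔ hd ν + (m ⊓ n ∸ r)    ≤⟨ +-monoˡ-≤ _ (⊔-lub μ≤r ν≤r) ⟩
    r + (m ⊓ n ∸ r)              ≡⟨ m+[n∸m]≡n (⊓-glb r≤m r≤n) ⟩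
    m ⊓ n                        ≤⟨ m⊓n≤m m n ⟩
    m                            ∎

glue-stripʳ : ∀ c {μ ν ρ} → HorizontalStrip ρ μ → HorizontalStrip ρ ν →
              HorizontalStrip ν (glue c μ ν ρ)
glue-stripʳ c {μ} {ν} {ρ} h k =
  subst (HorizontalStrip ν) (glue-comm c ν μ ρ) (glue-stripˡ c k h)

⊔+⊓ : ∀ m n → m ⊔ n + m ⊓ n ≡ m + n
⊔+⊓ zero    n       = +-identityʳ n
⊔+⊓ (suc m) zero    = refl
⊔+⊓ (suc m) (suc n) = cong suc (begin
  m ⊔ n + suc (m ⊓ n)    ≡⟨ +-suc (m ⊔ n) (m ⊓ n) ⟩
  suc (m ⊔ n + m ⊓ n)    ≡⟨ cong suc (⊔+⊓ m n) ⟩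
  suc (m + n)            ≡⟨ +-suc m n ⟨
  m + suc n              ∎)
  where open ≡-Reasoning

-- Row by row max and min add up to μᵣ + νᵣ, and the min - ρᵣ missing from one row reappears in the
-- next; only `c` is new. This is |λ/μ| = |ν/ρ| + c, and its mirror image, free of subtraction.
glue-sum : ∀ c {μ ν ρ} → HorizontalStrip ρ μ → HorizontalStrip ρ ν →
           sum (glue c μ ν ρ) + sum ρ ≡ sum μ + sum ν + c
glue-sum c [] [] = trans (+-identityʳ _) (sum-single c)
glue-sum c [] (last {n} _) =
  solve 2 (λ n c → n :+ c :+ con 0 :+ con 0 := n :+ con 0 :+ c) refl n c
  where open +-*-Solver
glue-sum c (last {m} _) [] =
  solve 2 (λ m c → m :+ c :+ con 0 :+ con 0 := m :+ con 0 :+ con 0 :+ c) refl m c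
  where open +-*-Solver
glue-sum c (last {m} _) (last {n} _) = begin
  m ⊔ n + c + sum (single (m ⊓ n)) + 0  ≡⟨ cong (λ s → m ⊔ n + c + s + 0) (sum-single (m ⊓ n)) ⟩
  m ⊔ n + c + m ⊓ n + 0                 ≡⟨ regroup (m ⊔ n) (m ⊓ n) c ⟩
  m ⊔ n + m ⊓ n + c                     ≡⟨ cong (_+ c) (⊔+⊓ m n) ⟩
  m + n + c                             ≡⟨ pad m n c ⟩
  m + 0 + (n + 0) + c                   ∎
  where
  open ≡-Reasoning
  open +-*-Solver
  regroup : ∀ a b c → a + c + b + 0 ≡ a + b + c
  regroup = solve 3 (λ a b c → a :+ c :+ b :+ con 0 := a :+ b :+ c) refl
  pad : ∀ a b c → a + b + c ≡ a + 0 + (b + 0) + c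
  pad = solve 3 (λ a b c → a :+ b :+ c := a :+ con 0 :+ (b :+ con 0) :+ c) refl
glue-sum c {m ∷ μ} {n ∷ ν} {r ∷ ρ} (cons _ r≤m _ h) (cons _ r≤n _ k) = begin
  m ⊔ n + c + sum (glue d μ ν ρ) + (r + sum ρ)    ≡⟨ regroup₁ (m ⊔ n) c (sum (glue d μ ν ρ)) r (sum ρ) ⟩
  m ⊔ n + c + r + (sum (glue d μ ν ρ) + sum ρ)    ≡⟨ cong (m ⊔ n + c + r +_) (glue-sum d h k) ⟩
  m ⊔ n + c + r + (sum μ + sum ν + d)             ≡⟨ regroup₂ (m ⊔ n) c r (sum μ) (sum ν) d ⟩
  m ⊔ n + (r + d) + (sum μ + sum ν) + c           ≡⟨ cong (λ s → m ⊔ n + s + (sum μ + sum ν) + c) (m+[n∸m]≡n (⊓-glb r≤m r≤n)) ⟩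
  m ⊔ n + m ⊓ n + (sum μ + sum ν) + c             ≡⟨ cong (λ s → s + (sum μ + sum ν) + c) (⊔+⊓ m n) ⟩
  m + n + (sum μ + sum ν) + c                     ≡⟨ regroup₃ m n (sum μ) (sum ν) c ⟩
  m + sum μ + (n + sum ν) + c                     ∎
  where
  d = m ⊓ n ∸ r
  open ≡-Reasoning
  open +-*-Solver
  regroup₁ : ∀ a c g r s → a + c + g + (r + s) ≡ a + c + r + (g + s)
  regroup₁ = solve 5 (λ a c g r s → a :+ c :+ g :+ (r :+ s) := a :+ c :+ r :+ (g :+ s)) refl
  regroup₂ : ∀ a c r x y d → a + c + r + (x + y + d) ≡ a + (r + d) + (x + y) + c
  regroup₂ = solve 6 (λ a c r x y d → a :+ c :+ r :+ (x :+ y :+ d) := a :+ (r :+ d) :+ (x :+ y) :+ c) refl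
  regroup₃ : ∀ m n x y c → m + n + (x + y) + c ≡ m + x + (n + y) + c
  regroup₃ = solve 5 (λ m n x y c → m :+ n :+ (x :+ y) :+ c := m :+ x :+ (n :+ y) :+ c) refl

-- The first part of λ exceeds max(μ₁, ν₁) by exactly `c`. The tail is glued with surplus min(μ₁,
-- ν₁) - ρ₁, so the same argument one row down recovers that surplus, and with it ρ₁, because ρ₁ ≤
-- min(μ₁, ν₁).
glue-injective : ∀ {c c′ μ ν ρ ρ′} →
                 HorizontalStrip ρ μ → HorizontalStrip ρ ν →
                 HorizontalStrip ρ′ μ → HorizontalStrip ρ′ ν →
                 glue c μ ν ρ ≡ glue c′ μ ν ρ′ → c ≡ c′ × ρ ≡ ρ′
glue-injective {c} {c′} {[]} {[]} [] _ [] _ eq =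
  trans (sym (hd-single c)) (trans (cong hd eq) (hd-single c′)) , refl
glue-injective {μ = []} {ν = n ∷ ν} [] _ [] _ eq = +-cancelˡ-≡ n _ _ (∷-injectiveˡ eq) , refl
glue-injective {μ = m ∷ μ} {ν = []} _ [] _ [] eq = +-cancelˡ-≡ m _ _ (∷-injectiveˡ eq) , refl
glue-injective {μ = m ∷ μ} {ν = n ∷ ν} {ρ} {ρ′} h k h′ k′ eq
  with strip-tl h | strip-tl k | strip-tl h′ | strip-tl k′
... | ht , r≤m | kt , r≤n | ht′ , r≤m′ | kt′ , r≤n′
  with glue-injective ht kt ht′ kt′ (∷-injectiveʳ eq)
... | d≡d′ , tl≡ = +-cancelˡ-≡ (m ⊔ n) _ _ (∷-injectiveˡ eq) , recombine h h′ hd≡ tl≡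
  where
  hd≡ : hd ρ ≡ hd ρ′
  hd≡ = ∸-cancelˡ-≡ (⊓-glb r≤m r≤n) (⊓-glb r≤m′ r≤n′) d≡d′
  -- `hd` is 0 on the empty list, so equal heads and tails alone do not separate [] from 0 ∷ []; the
  -- absence of zero parts does.
  recombine : ∀ {ρ ρ′ κ} → HorizontalStrip ρ κ → HorizontalStrip ρ′ κ →
              hd ρ ≡ hd ρ′ → tl ρ ≡ tl ρ′ → ρ ≡ ρ′
  recombine {[]}    x y p q = sym (strip-lower-[] y (sym p))
  recombine {_ ∷ _} {[]}    x y p q = strip-lower-[] x p
  recombine {_ ∷ _} {_ ∷ _} x y p q = cong₂ _∷_ p q

Unglued : List ℕ → List ℕ → List ℕ → Set
Unglued μ ν lam = ∃[ c ] ∃[ ρ ] (HorizontalStrip ρ μ × HorizontalStrip ρ ν × lam ≡ glue c μ ν ρ)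

-- The inverse rule runs from the bottom row up: ungluing the rows below yields the surplus `c` they
-- received, so the part of ρ in the current row has to be min(m, n) - c. The outer surplus is the
-- excess of l over max(m, n).
glue-surjective : ∀ {μ ν lam} → HorizontalStrip μ lam → HorizontalStrip ν lam → Unglued μ ν lam
glue-surjective [] [] = 0 , [] , [] , [] , refl
glue-surjective (last {l} 0<l) (last _) = l , [] , [] , [] , sym (single-positive 0<l)
glue-surjective (last {l} 0<l) (cons {n} 0<n n≤l _ []) =
  l ∸ n , [] , [] , last 0<n , cong (_∷ []) (sym (m+[n∸m]≡n n≤l))
glue-surjective (cons {m} 0<m m≤l _ []) (last {l} 0<l) =
  l ∸ m , [] , last 0<m , [] , cong (_∷ []) (sym (m+[n∸m]≡n m≤l))
glue-surjective {m ∷ μ} {n ∷ ν} {l ∷ lam} (cons 0<m m≤l lam≤m h) (cons 0<n n≤l lam≤n k)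
  with glue-surjective h k
... | c , ρ , hρ , kρ , refl = l ∸ (m ⊔ n) , rest (m ⊓ n ∸ c) refl
  where
  c-bound : hd μ ⊔ hd ν + c ≤ m ⊓ n
  c-bound = subst (_≤ m ⊓ n) (hd-glue c μ ν ρ) (⊓-glb lam≤m lam≤n)
  c≤ : c ≤ m ⊓ n
  c≤ = m+n≤o⇒n≤o (hd μ ⊔ hd ν) c-bound
  head≡ : l ≡ m ⊔ n + (l ∸ (m ⊔ n))
  head≡ = sym (m+[n∸m]≡n (⊔-lub m≤l n≤l))
  -- The new part is abstracted as r because r = 0 must not be put in front of ρ.
  rest : ∀ r → m ⊓ n ∸ c ≡ r →
         ∃[ ρ⁺ ] (HorizontalStrip ρ⁺ (m ∷ μ) × HorizontalStrip ρ⁺ (n ∷ ν) ×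
                  l ∷ glue c μ ν ρ ≡ glue (l ∸ (m ⊔ n)) (m ∷ μ) (n ∷ ν) ρ⁺)
  -- A new part 0 forces μ, ν and hence ρ to be empty, so nothing is added.
  rest zero eq with strip-upper-[] hρ (n≤0⇒n≡0 (≤-trans (m≤m⊔n _ _) max≤0))
                  | strip-upper-[] kρ (n≤0⇒n≡0 (≤-trans (m≤n⊔m (hd μ) _) max≤0))
    where
    max≤0 : hd μ ⊔ hd ν ≤ 0
    max≤0 = +-cancelʳ-≤ c _ _ (≤-trans c-bound (m∸n≡0⇒m≤n eq))
  ... | refl , refl | _ , refl =
    [] , last 0<m , last 0<n ,
    cong₂ _∷_ head≡ (cong single (≤-antisym c≤ (m∸n≡0⇒m≤n eq)))
  rest r@(suc _) eq =
    r ∷ ρ ,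
    cons (s≤s z≤n) (≤-trans r≤ (m⊓n≤m m n)) (≤-trans (m≤m⊔n _ _) max≤r) hρ ,
    cons (s≤s z≤n) (≤-trans r≤ (m⊓n≤n m n)) (≤-trans (m≤n⊔m (hd μ) _) max≤r) kρ ,
    cong₂ _∷_ head≡ (cong (λ d → glue d μ ν ρ) c≡)
    where
    r≤ : r ≤ m ⊓ n
    r≤ = subst (_≤ m ⊓ n) eq (m∸n≤m (m ⊓ n) c)
    max≤r : hd μ ⊔ hd ν ≤ r
    max≤r = subst (hd μ ⊔ hd ν ≤_) eq (m+n≤o⇒m≤o∸n (hd μ ⊔ hd ν) c-bound)
    c≡ : c ≡ m ⊓ n ∸ r
    c≡ = trans (sym (m∸[m∸n]≡n c≤)) (cong (m ⊓ n ∸_) eq)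

-- Growth of chains

ΣFin-suc : ∀ {N} (f : Fin (suc N) → ℕ) → ΣFin (suc N) f ≡ f zero + ΣFin N (f ∘ suc)
ΣFin-suc f = cong (λ xs → f zero + sum xs)
  (trans (map-tabulate suc f) (sym (map-tabulate (λ i → i) (f ∘ suc))))

countP-++ : ∀ {A : Set} {P : A → Set} (P? : ∀ a → Dec (P a)) (xs ys : List A) →
            countP P? (xs ++ ys) ≡ countP P? xs + countP P? ys
countP-++ P? xs ys = trans (cong length (filter-++ P? xs ys)) (length-++ (filter P? xs))

countP-map : ∀ {A B : Set} {P : B → Set} (P? : ∀ b → Dec (P b)) (f : A → B) (xs : List A) →
             countP P? (map f xs) ≡ countP (P? ∘ f) xs
countP-map P? f []       = refl
countP-map P? f (x ∷ xs) with does (P? (f x))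
... | true  = cong suc (countP-map P? f xs)
... | false = countP-map P? f xs

-- Coloured chains and one row of a growth diagram

Step : Set → Set
Step C = List ℕ × List C

Chain : Set → ℕ → Set
Chain C = Vec (Step C)

Row : Set → ℕ → Set
Row C = Vec (List (C × C))

shape : ∀ {C m} → Chain C m → List ℕ
shape []            = []
shape ((lam , _) ∷ _) = lam

wordAt : ∀ {C m} → Chain C m → Fin m → List C
wordAt c p = proj₂ (lookup c p)

-- The chain ∅ ≺ … ≺ λ underlying a tableau, the largest letter coming first;
-- each strip carries the word of the colours of its cells.
Valid : ∀ {C m} → Chain C m → Set
Valid []              = ⊤
Valid ((lam , w) ∷ c) =
  HorizontalStrip (shape c) lam × length w + sum (shape c) ≡ sum lam × Valid c

-- In the cell at the head, with `c` the tail of the chain, the corners are ρ = `shape c`, μ, ν =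
-- `shape c⁺` and the glued shape. First components of `z` extend the word of μ/ρ to one for the
-- strip over ν; second components extend the word of ν/ρ to one for the strip over μ. The returned
-- word colours the strip from the old head shape to the new one.
addRow : ∀ {C m} → Chain C m → Row C m → Chain C m × List C
addRow []            []       = [] , []
addRow ((μ , u) ∷ c) (z ∷ zs) =
  let (c⁺ , w) = addRow c zs
  in (glue (length z) μ (shape c⁺) (shape c) , map proj₁ z ++ u) ∷ c⁺ , map proj₂ z ++ w

-- `w` colours the strip from μ up to `shape c`. These are exactly the outputs of `addRow` on valid
-- chains of shape μ.
Removable : ∀ {C m} → Chain C m → List ℕ → List C → Set
Removable c μ w = Valid c × HorizontalStrip μ (shape c) × length w + sum μ ≡ sum (shape c)

length-map-++ : ∀ {A B : Set} (f : A → B) xs ys → length (map f xs ++ ys) ≡ length xs + length ys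
length-map-++ f xs ys = trans (length-++ (map f xs)) (cong (_+ length ys) (length-map f xs))

-- Sizes in one cell: r = |ρ|, a = |μ|, b = |ν|, s = |λ|, k is the surplus and x the number of
-- colours on μ/ρ. The second hypothesis is `glue-sum`; exchanging a and b gives the other two
-- strips.
strip-size : ∀ {x k r a b s} → x + r ≡ a → s + r ≡ a + b + k → k + x + b ≡ s
strip-size {x} {k} {r} {_} {b} {s} refl eq = +-cancelʳ-≡ r _ _ (trans
  (solve 4 (λ k x b r → k :+ x :+ b :+ r := x :+ r :+ b :+ k) refl k x b r) (sym eq))
  where open +-*-Solver

strip-size⁻ : ∀ {x k r a b s} → k + x + b ≡ s → s + r ≡ a + b + k → x + r ≡ a
strip-size⁻ {x} {k} {r} {a} {b} refl eq = +-cancelʳ-≡ (b + k) _ _ (trans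
  (solve 4 (λ k x b r → x :+ r :+ (b :+ k) := k :+ x :+ b :+ r) refl k x b r)
  (trans eq (+-assoc a b k)))
  where open +-*-Solver

-- Here x counts the colours on λ/ν, that is |μ/ρ| + k, so a prefix of length k can be cut off.
overlap≤ : ∀ {x k r a b s} → r ≤ a → x + b ≡ s → s + r ≡ a + b + k → k ≤ x
overlap≤ {x} {k} {r} {a} {b} r≤a refl eq = +-cancelʳ-≤ (b + a) k x (begin
  k + (b + a)  ≡⟨ solve 3 (λ k b a → k :+ (b :+ a) := a :+ b :+ k) refl k b a ⟩
  a + b + k    ≡⟨ eq ⟨
  x + b + r    ≤⟨ +-monoʳ-≤ (x + b) r≤a ⟩
  x + b + a    ≡⟨ +-assoc x b a ⟩
  x + (b + a)  ∎)
  where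
  open ≤-Reasoning
  open +-*-Solver

addRow-removable : ∀ {C m} (c : Chain C m) zs → Valid c →
                   Removable (proj₁ (addRow c zs)) (shape c) (proj₂ (addRow c zs))
addRow-removable []            []       _ = tt , [] , refl
addRow-removable ((μ , u) ∷ c) (z ∷ zs) (h , |u| , v)
  with addRow c zs | addRow-removable c zs v
... | c⁺ , w | v⁺ , k , |w| =
  ( glue-stripʳ (length z) h k
  , trans (cong (_+ sum (shape c⁺)) (length-map-++ proj₁ z u)) (strip-size |u| glued)
  , v⁺ )
  , glue-stripˡ (length z) h k
  , trans (cong (_+ sum μ) (length-map-++ proj₂ z w))
          (strip-size |w| (trans glued (cong (_+ length z) (+-comm (sum μ) _))))
  where
  glued = glue-sum (length z) h k

unzip-prefix : ∀ {C : Set} k {w w′ : List C} → k ≤ length w → k ≤ length w′ →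
               ∃[ z ] ∃[ u ] ∃[ u′ ] (length z ≡ k × w ≡ map proj₁ z ++ u × w′ ≡ map proj₂ z ++ u′)
unzip-prefix zero    {w} {w′} _ _ = [] , w , w′ , refl , refl , refl
unzip-prefix (suc k) {x ∷ w} {y ∷ w′} (s≤s p) (s≤s q)
  with unzip-prefix k {w} {w′} p q
... | z , u , u′ , refl , refl , refl = (x , y) ∷ z , u , u′ , refl , refl , refl

-- Each cell is undone from its outer corner: `glue-surjective` finds ρ and the surplus `o`, the
-- first `o` colours of both words are zipped into the entry of the cell, and the rest of the second
-- word has the right length for the remaining cells.
addRow-surjective : ∀ {C m} (c : Chain C m) {μ w} → Removable c μ w →
                    ∃[ c⁻ ] ∃[ zs ] (Valid c⁻ × shape c⁻ ≡ μ × addRow c⁻ zs ≡ (c , w))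
addRow-surjective [] {w = []} (_ , [] , _) = [] , [] , tt , refl , refl
addRow-surjective ((lam , w) ∷ c) {μ} {w′} ((k , |w| , v) , h , |w′|)
  with glue-surjective h k
... | o , ρ , hρ , kρ , refl
  with glue-sum o hρ kρ
... | glued
  with trans glued (cong (_+ o) (+-comm (sum μ) (sum (shape c))))
... | glued′
  with unzip-prefix o {w} {w′} (overlap≤ (strip-sum hρ) |w| glued) (overlap≤ (strip-sum kρ) |w′| glued′)
... | z , u , u′ , refl , refl , refl
  with addRow-surjective c {w = u′}
         (v , kρ , strip-size⁻ (trans (cong (_+ sum μ) (sym (length-map-++ proj₂ z u′))) |w′|) glued′)
... | c⁻ , zs , v⁻ , refl , refl =
  (μ , u) ∷ c⁻ , z ∷ zs ,
  (hρ , strip-size⁻ (trans (cong (_+ sum (shape c)) (sym (length-map-++ proj₁ z u))) |w|) glued , v⁻) ,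
  refl , refl

++-cancel-length : ∀ {A : Set} {xs xs′ ys ys′ : List A} → length xs ≡ length xs′ →
                   xs ++ ys ≡ xs′ ++ ys′ → xs ≡ xs′ × ys ≡ ys′
++-cancel-length {xs = []}    {[]}     _ eq = refl , eq
++-cancel-length {xs = x ∷ xs} {_ ∷ xs′} p eq with ∷-injective eq
... | refl , eq′ with ++-cancel-length {xs = xs} {xs′} (suc-injective p) eq′
... | refl , ys≡ = refl , ys≡

unzip-injective : ∀ {A B : Set} {z z′ : List (A × B)} →
                  map proj₁ z ≡ map proj₁ z′ → map proj₂ z ≡ map proj₂ z′ → z ≡ z′
unzip-injective {z = []}    {[]}     _ _ = refl
unzip-injective {z = _ ∷ _} {_ ∷ _}  p q =
  cong₂ _∷_ (cong₂ _,_ (∷-injectiveˡ p) (∷-injectiveˡ q))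
            (unzip-injective (∷-injectiveʳ p) (∷-injectiveʳ q))

unzip-prefix-injective : ∀ {C : Set} {z z′ : List (C × C)} {u u′ w w′} → length z ≡ length z′ →
  map proj₁ z ++ u ≡ map proj₁ z′ ++ u′ → map proj₂ z ++ w ≡ map proj₂ z′ ++ w′ →
  z ≡ z′ × u ≡ u′ × w ≡ w′
unzip-prefix-injective {z = z} {z′} |z| p q
  with ++-cancel-length {xs = map proj₁ z} (lengths proj₁) p | ++-cancel-length {xs = map proj₂ z} (lengths proj₂) q
  where
  lengths : ∀ f → length (map f z) ≡ length (map f z′)
  lengths f = trans (length-map f z) (trans |z| (sym (length-map f z′)))
... | p₁ , u≡ | p₂ , w≡ = unzip-injective p₁ p₂ , u≡ , w≡

-- In a cell, μ, ν and λ determine ρ and the surplus. The assumption supplies μ; `glue-injective`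
-- then returns equality of the inner corners, which is the assumption for the next cell. Equal
-- surpluses also fix where the words are cut.
addRow-injective : ∀ {C m} (c c′ : Chain C m) zs zs′ → Valid c → Valid c′ → shape c ≡ shape c′ →
                   addRow c zs ≡ addRow c′ zs′ → c ≡ c′ × zs ≡ zs′
addRow-injective [] [] [] [] _ _ _ _ = refl , refl
addRow-injective ((μ , u) ∷ c) ((_ , u′) ∷ c′) (z ∷ zs) (z′ ∷ zs′) (h , _ , v) (h′ , _ , v′) refl eq
  with addRow c zs in e | addRow c′ zs′ in e′ | addRow-removable c zs v | addRow-removable c′ zs′ v′
... | c⁺ , w | c⁺′ , w′ | _ , k , _ | _ , k′ , _
  with ,-injective eq
... | chain≡ , word≡
  with ∷ᵥ-injective chain≡
... | step≡ , refl
  with ,-injective step≡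
... | shape≡ , strip≡
  with glue-injective h k h′ k′ shape≡
... | |z| , ρ≡
  with unzip-prefix-injective {z = z} {z′} |z| strip≡ word≡
... | refl , refl , refl
  with addRow-injective c c′ zs zs′ v v′ ρ≡ (trans e (sym e′))
... | refl , refl = refl , refl

addRow-wordAt : ∀ {C m} (c : Chain C m) zs p →
                wordAt (proj₁ (addRow c zs)) p ≡ map proj₁ (lookup zs p) ++ wordAt c p
addRow-wordAt (_ ∷ c) (z ∷ zs) zero    = refl
addRow-wordAt (_ ∷ c) (z ∷ zs) (suc p) = addRow-wordAt c zs p

addRow-count : ∀ {C : Set} {m} {P : C → Set} (P? : ∀ a → Dec (P a)) (c : Chain C m) zs →
               countP P? (proj₂ (addRow c zs)) ≡ ΣFin m (λ p → countP (P? ∘ proj₂) (lookup zs p))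
addRow-count P? []      []       = refl
addRow-count {m = suc m} P? (_ ∷ c) (z ∷ zs) = begin
  countP P? (map proj₂ z ++ w)                ≡⟨ countP-++ P? (map proj₂ z) w ⟩
  countP P? (map proj₂ z) + countP P? w       ≡⟨ cong₂ _+_ (countP-map P? proj₂ z) (addRow-count P? c zs) ⟩
  countP (P? ∘ proj₂) z + ΣFin m (λ p → countP (P? ∘ proj₂) (lookup zs p))
                                              ≡⟨ ΣFin-suc (λ p → countP (P? ∘ proj₂) (lookup (z ∷ zs) p)) ⟨
  ΣFin (suc m) (λ p → countP (P? ∘ proj₂) (lookup (z ∷ zs) p))  ∎
  where
  w = proj₂ (addRow c zs)
  open ≡-Reasoning

-- Whole growth diagrams: matrices against pairs of chains of equal shape

Matrix : Set → ℕ → ℕ → Set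
Matrix C m m′ = Vec (Row C m) m′

emptyChain : ∀ {C} m → Chain C m
emptyChain m = replicate m ([] , [])

-- The diagram grows from an empty boundary, the last row of the matrix first. The first chain is
-- the edge along the newest row; the second records, after each row, the corner reached and the
-- word that row passed out. Both edges end in the same corner.
toChains : ∀ {C m m′} → Matrix C m m′ → Chain C m × Chain C m′
toChains {m = m} []       = emptyChain m , []
toChains         (zs ∷ Z) =
  let (c , c′) = toChains Z
      (c⁺ , w) = addRow c zs
  in c⁺ , (shape c⁺ , w) ∷ c′

ChainPair : ∀ {C m m′} → Chain C m × Chain C m′ → Set
ChainPair (c , c′) = Valid c × Valid c′ × shape c ≡ shape c′

shape-emptyChain : ∀ C m → shape (emptyChain {C} m) ≡ []
shape-emptyChain C zero    = refl
shape-emptyChain C (suc m) = refl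

valid-emptyChain : ∀ C m → Valid (emptyChain {C} m)
valid-emptyChain C zero    = tt
valid-emptyChain C (suc m)
  rewrite shape-emptyChain C m = [] , refl , valid-emptyChain C m

-- Only ∅ lies below ∅, and the size condition then leaves no colours.
shape-[]⇒emptyChain : ∀ {C m} (c : Chain C m) → Valid c → shape c ≡ [] → c ≡ emptyChain m
shape-[]⇒emptyChain []             _ _ = refl
shape-[]⇒emptyChain ((_ , w) ∷ c) (h , |w| , v) refl
  with shape c in e | h
... | [] | [] with w | |w|
... | [] | _ = cong (_ ∷_) (shape-[]⇒emptyChain c v e)

toChains-valid : ∀ {C m m′} (Z : Matrix C m m′) → ChainPair (toChains Z)
toChains-valid {C} {m} [] = valid-emptyChain C m , tt , shape-emptyChain C m
toChains-valid (zs ∷ Z) with toChains Z | toChains-valid Z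
... | c , c′ | v , v′ , s≡ with addRow-removable c zs v
... | v⁺ , h , |w| rewrite s≡ = v⁺ , (h , |w| , v′) , refl

toChains-surjective : ∀ {C m m′} (c : Chain C m) (c′ : Chain C m′) → ChainPair (c , c′) →
                      ∃[ Z ] (toChains Z ≡ (c , c′))
toChains-surjective c [] (v , _ , s≡) = [] , cong (_, []) (sym (shape-[]⇒emptyChain c v s≡))
toChains-surjective c ((_ , w) ∷ c′) (v , (h , |w| , v′) , refl)
  with addRow-surjective c {w = w} (v , h , |w|)
... | c⁻ , zs , v⁻ , s≡ , refl
  with toChains-surjective c⁻ c′ (v⁻ , v′ , s≡)
... | Z , refl = zs ∷ Z , refl

-- The second chain stores the corner reached before each row, so equal outputs force equal starting
-- shapes, as `addRow-injective` requires.
toChains-injective : ∀ {C m m′} (Z Z′ : Matrix C m m′) → toChains Z ≡ toChains Z′ → Z ≡ Z′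
toChains-injective []       []         _  = refl
toChains-injective (zs ∷ Z) (zs′ ∷ Z′) eq
  with toChains Z in e | toChains Z′ in e′ | toChains-valid Z | toChains-valid Z′
... | c , d | c′ , d′ | v , _ , s≡ | v′ , _ , s≡′
  with ,-injective eq
... | c≡ , d≡
  with ∷ᵥ-injective d≡
... | step≡ , refl
  with addRow-injective c c′ zs zs′ v v′ (trans s≡ (sym s≡′)) (cong₂ _,_ c≡ (proj₂ (,-injective step≡)))
... | refl , refl = cong (zs ∷_) (toChains-injective Z Z′ (trans e (sym e′)))

toChains-count₁ : ∀ {C : Set} {m m′} {P : C → Set} (P? : ∀ a → Dec (P a)) (Z : Matrix C m m′) p →
  countP P? (wordAt (proj₁ (toChains Z)) p) ≡
  ΣFin m′ (λ q → countP (P? ∘ proj₁) (lookup (lookup Z q) p))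
toChains-count₁ {C} {m} P? [] p = cong (countP P?) (empty m p)
  where
  empty : ∀ m p → wordAt (emptyChain {C} m) p ≡ []
  empty (suc m) zero    = refl
  empty (suc m) (suc p) = empty m p
toChains-count₁ {m′ = suc m′} P? (zs ∷ Z) p = begin
  countP P? (wordAt (proj₁ (addRow c zs)) p)             ≡⟨ cong (countP P?) (addRow-wordAt c zs p) ⟩
  countP P? (map proj₁ (lookup zs p) ++ wordAt c p)      ≡⟨ countP-++ P? (map proj₁ (lookup zs p)) _ ⟩
  countP P? (map proj₁ (lookup zs p)) + countP P? (wordAt c p)
    ≡⟨ cong₂ _+_ (countP-map P? proj₁ (lookup zs p)) (toChains-count₁ P? Z p) ⟩
  f zero + ΣFin m′ (f ∘ suc)                             ≡⟨ ΣFin-suc f ⟨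
  ΣFin (suc m′) f                                        ∎
  where
  c = proj₁ (toChains Z)
  f = λ q → countP (P? ∘ proj₁) (lookup (lookup (zs ∷ Z) q) p)
  open ≡-Reasoning

toChains-count₂ : ∀ {C : Set} {m m′} {P : C → Set} (P? : ∀ a → Dec (P a)) (Z : Matrix C m m′) q →
  countP P? (wordAt (proj₂ (toChains Z)) q) ≡
  ΣFin m (λ p → countP (P? ∘ proj₂) (lookup (lookup Z q) p))
toChains-count₂ P? (zs ∷ Z) zero    = addRow-count P? (proj₁ (toChains Z)) zs
toChains-count₂ P? (zs ∷ Z) (suc q) = toChains-count₂ P? Z q

-- Strips of a tableau

firstRow : ∀ {N n} → Filling N n → List (Letter N n)
firstRow []      = []
firstRow (r ∷ _) = r

-- The tableau conditions arranged for induction on rows, with indices restricted to `is`. Non-empty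
-- rows keep `rowLengths` free of zero parts; weak increase is stated for all pairs so that rows can
-- be cut and extended at the strip.
TableauOver : ∀ {N n m} → Vec (Fin N) m → Filling N n → Set
TableauOver is []      = ⊤
TableauOver is (r ∷ T) =
  0 < length r × AllPairs _≤A_ r × All (λ a → proj₁ a ∈ᵥ is) r × ColStrict r (firstRow T) ×
  TableauOver is T

Decreasing : ∀ {N m} → Vec (Fin N) m → Set
Decreasing = AllPairsᵥ (λ i j → toℕ j < toℕ i)

Below : ∀ {N m} → Fin N → Vec (Fin N) m → Set
Below i = Allᵥ.All (λ j → toℕ j < toℕ i)

-- The colours are dealt from the top row down: each row takes as many as it grows by, and a new
-- last row takes all that remain.
addStrip : ∀ {N n} → Fin N → List ℕ → Filling N n → List (Fin n) → Filling N n
addStrip i []        _       w = []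
addStrip i (l ∷ lam) []      w = map (i ,_) w ∷ []
addStrip i (l ∷ lam) (r ∷ T) w =
  (r ++ map (i ,_) (take (l ∸ length r) w)) ∷ addStrip i lam T (drop (l ∸ length r) w)

rowLengths : ∀ {N n} → Filling N n → List ℕ
rowLengths = map length

Strippable : ∀ {N n} → List ℕ → Filling N n → List (Fin n) → Set
Strippable lam T w = HorizontalStrip (rowLengths T) lam × length w + sum (rowLengths T) ≡ sum lam

-- m and l are the old and new lengths of the top row, s and s′ the totals below. The lower rows do
-- not shrink, so at least l - m colours are at hand, and the remainder fits the strip below
-- exactly.
deal : ∀ {A : Set} {m l s s′} (w : List A) → m ≤ l → s ≤ s′ → length w + (m + s) ≡ l + s′ →
       length (take (l ∸ m) w) ≡ l ∸ m × length (drop (l ∸ m) w) + s ≡ s′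
deal {m = m} {l} {s} {s′} w m≤l s≤s′ eq = trans (length-take d w) (m≤n⇒m⊓n≡m d≤) , dropped
  where
  open ≤-Reasoning
  open +-*-Solver
  d = l ∸ m
  l≡ : m + d ≡ l
  l≡ = m+[n∸m]≡n m≤l
  d≤ : d ≤ length w
  d≤ = +-cancelʳ-≤ (m + s) d (length w) (begin
    d + (m + s)         ≡⟨ solve 3 (λ d m s → d :+ (m :+ s) := m :+ d :+ s) refl d m s ⟩
    m + d + s           ≡⟨ cong (_+ s) l≡ ⟩
    l + s               ≤⟨ +-monoʳ-≤ l s≤s′ ⟩
    l + s′              ≡⟨ eq ⟨
    length w + (m + s)  ∎)
  dropped : length (drop d w) + s ≡ s′
  dropped = +-cancelˡ-≡ l _ _ (begin-equality
    l + (length (drop d w) + s)          ≡⟨ cong₂ (λ x y → x + (y + s)) (sym l≡) (length-drop d w) ⟩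
    m + d + (length w ∸ d + s)           ≡⟨ solve 4 (λ m d x s → m :+ d :+ (x :+ s) := d :+ x :+ (m :+ s)) refl m d (length w ∸ d) s ⟩
    d + (length w ∸ d) + (m + s)         ≡⟨ cong (_+ (m + s)) (m+[n∸m]≡n d≤) ⟩
    length w + (m + s)                   ≡⟨ eq ⟩
    l + s′                               ∎)

strippable-tail : ∀ {N n l lam} {r : List (Letter N n)} {T w} → Strippable (l ∷ lam) (r ∷ T) w →
  length r ≤ l × length (take (l ∸ length r) w) ≡ l ∸ length r ×
  Strippable lam T (drop (l ∸ length r) w)
strippable-tail {w = w} (cons _ r≤l _ h , size) with deal w r≤l (strip-sum h) size
... | taken , dropped = r≤l , taken , h , dropped

rowLengths-addStrip : ∀ {N n} (i : Fin N) lam (T : Filling N n) w → Strippable lam T w →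
                      rowLengths (addStrip i lam T w) ≡ lam
rowLengths-addStrip i []        []      w _ = refl
rowLengths-addStrip i (l ∷ [])  []      w (last _ , size) = cong (_∷ []) (begin
  length (map (i ,_) w)   ≡⟨ length-map (i ,_) w ⟩
  length w                ≡⟨ +-identityʳ _ ⟨
  length w + 0            ≡⟨ size ⟩
  l + 0                   ≡⟨ +-identityʳ l ⟩
  l                       ∎)
  where open ≡-Reasoning
rowLengths-addStrip i (l ∷ lam) (r ∷ T) w st with strippable-tail {r = r} {T} {w} st
... | r≤l , taken , st′ = cong₂ _∷_ row (rowLengths-addStrip i lam T _ st′)
  where
  row : length (r ++ map (i ,_) (take (l ∸ length r) w)) ≡ l
  row = trans (length-++ r) (trans (cong (length r +_) (trans (length-map (i ,_) (take (l ∸ length r) w)) taken)) (m+[n∸m]≡n r≤l))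

length-firstRow : ∀ {N n} (T : Filling N n) → length (firstRow T) ≡ hd (rowLengths T)
length-firstRow []      = refl
length-firstRow (_ ∷ _) = refl

firstRow-addStrip : ∀ {N n} (i : Fin N) lam (T : Filling N n) w → Strippable lam T w →
                    ∃[ u ] (firstRow (addStrip i lam T w) ≡ firstRow T ++ map (i ,_) u)
firstRow-addStrip i []        []      w _ = [] , refl
firstRow-addStrip i (l ∷ lam) []      w _ = w , refl
firstRow-addStrip i (l ∷ lam) (r ∷ T) w _ = take (l ∸ length r) w , refl

colStrict-++ˡ : ∀ {N n} {r s x : List (Letter N n)} → ColStrict r s → ColStrict (r ++ x) s
colStrict-++ˡ {s = []}                  _       = tt
colStrict-++ˡ {r = _ ∷ _} {_ ∷ _} (a<b , p) = a<b , colStrict-++ˡ p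

colStrict-prefix : ∀ {N n} {r : List (Letter N n)} s {x} → ColStrict r (s ++ x) → ColStrict r s
colStrict-prefix                []      _         = tt
colStrict-prefix {r = _ ∷ _} (_ ∷ s) (a<b , p) = a<b , colStrict-prefix s p

-- The length bound keeps the new cells from reaching past the end of `r`, so each lies under a
-- letter of `r`, whose index is smaller than i.
colStrict-extend : ∀ {N n} {i : Fin N} {r : List (Letter N n)} s u → ColStrict r s →
  All (λ a → toℕ (proj₁ a) < toℕ i) r → length (s ++ map (i ,_) u) ≤ length r →
  ColStrict r (s ++ map (i ,_) u)
colStrict-extend             []      []      _         _         _       = tt
colStrict-extend {r = _ ∷ _} []      (_ ∷ u) _         (a<i ∷ p) (s≤s q) = a<i , colStrict-extend [] u tt p q
colStrict-extend {r = _ ∷ _} (_ ∷ s) u       (a<b , c) (_ ∷ p)   (s≤s q) = a<b , colStrict-extend s u c p q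

-- No index in `s` exceeds i, so nothing can stand under a cell of index i. The next row therefore
-- lies under `r` alone, which is the interlacing condition of a horizontal strip.
colStrict-drop : ∀ {N n} {i : Fin N} (r : List (Letter N n)) u s →
  All (λ b → ¬ (toℕ i < toℕ (proj₁ b))) s → ColStrict (r ++ map (i ,_) u) s →
  ColStrict r s × length s ≤ length r
colStrict-drop r       u       []      _         _         = tt , z≤n
colStrict-drop []      (_ ∷ u) (_ ∷ s) (i≮b ∷ _) (i<b , _) = ⊥-elim (i≮b i<b)
colStrict-drop (_ ∷ r) u       (_ ∷ s) (_ ∷ ps)  (a<b , c) with colStrict-drop r u s ps c
... | c′ , s≤r = (a<b , c′) , s≤s s≤r

strip-row : ∀ {N n} {i : Fin N} (u : List (Fin n)) → AllPairs _≤A_ (map (i ,_) u)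
strip-row u = AllPairs.map⁺ (universal u)
  where
  universal : ∀ {N n} {i : Fin N} (u : List (Fin n)) → AllPairs (λ c d → (i , c) ≤A (i , d)) u
  universal []      = []
  universal (_ ∷ u) = All.universal (λ _ → <-irrefl refl) u ∷ universal u

below-row : ∀ {N n m} {i : Fin N} {is : Vec (Fin N) m} {r : List (Letter N n)} → Below i is →
            All (λ a → proj₁ a ∈ᵥ is) r → All (λ a → toℕ (proj₁ a) < toℕ i) r
below-row below = All.map (Allᵥ.lookup below)

not-above : ∀ {N m} {i : Fin N} {is : Vec (Fin N) m} → Below i is →
            ∀ {j} → j ∈ᵥ (i ∷ is) → ¬ (toℕ i < toℕ j)
not-above below (here refl)  i<i = <-irrefl refl i<i
not-above below (there j∈is) i<j = <-asym i<j (Allᵥ.lookup below j∈is)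

addStrip-tableau : ∀ {N n m} {i : Fin N} {is : Vec (Fin N) m} → Below i is →
  ∀ lam (T : Filling N n) w → TableauOver is T → Strippable lam T w →
  TableauOver (i ∷ is) (addStrip i lam T w)
addStrip-tableau below []       []      w _ _ = tt
addStrip-tableau {i = i} below (l ∷ []) [] w _ (last 0<l , size) =
  subst (0 <_) (sym len) 0<l , strip-row w , All.map⁺ (All.universal (λ _ → here refl) w) , tt , tt
  where
  len = ∷-injectiveˡ (rowLengths-addStrip i (l ∷ []) [] w (last 0<l , size))
addStrip-tableau {i = i} below (l ∷ lam) (r ∷ T) w (0<r , inc , r∈is , col , tab) st@(cons _ _ lam≤r _ , _)
  with strippable-tail {r = r} {T} {w} st
... | r≤l , taken , st′ =
  ≤-trans 0<r (length-++-≤ˡ r) ,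
  AllPairs.++⁺ inc (strip-row u) (All.map (λ a<i → All.map⁺ (All.universal (λ _ → <-asym a<i) u)) r<i) ,
  All.++⁺ (All.map there r∈is) (All.map⁺ (All.universal (λ _ → here refl) u)) ,
  colStrict-++ˡ strict ,
  addStrip-tableau below lam T w′ tab st′
  where
  u = take (l ∸ length r) w
  w′ = drop (l ∸ length r) w
  r<i = below-row below r∈is
  next≤r : length (firstRow (addStrip i lam T w′)) ≤ length r
  next≤r = subst (_≤ length r)
    (sym (trans (length-firstRow (addStrip i lam T w′)) (cong hd (rowLengths-addStrip i lam T w′ st′)))) lam≤r
  strict : ColStrict r (firstRow (addStrip i lam T w′))
  strict with firstRow (addStrip i lam T w′) | firstRow-addStrip i lam T w′ st′ | next≤r
  ... | _ | v , refl | bound = colStrict-extend (firstRow T) v col r<i bound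

-- i is the largest index available, so from its first occurrence on any smaller index would break
-- the weak increase.
split-row : ∀ {N n m} {i : Fin N} {is : Vec (Fin N) m} → Below i is → (r : List (Letter N n)) →
  AllPairs _≤A_ r → All (λ a → proj₁ a ∈ᵥ (i ∷ is)) r →
  ∃[ r⁻ ] ∃[ u ] (r ≡ r⁻ ++ map (i ,_) u × AllPairs _≤A_ r⁻ × All (λ a → proj₁ a ∈ᵥ is) r⁻)
split-row below [] [] [] = [] , [] , refl , [] , []
split-row {i = i} below ((.i , c) ∷ r) (i≤r ∷ inc) (here refl ∷ r∈) = [] , c ∷ proj₁ rest , cong (_ ∷_) (proj₂ rest) , [] , []
  where
  all-i : ∀ r → All ((i , c) ≤A_) r → All (λ a → proj₁ a ∈ᵥ (i ∷ _)) r → ∃[ u ] (r ≡ map (i ,_) u)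
  all-i []            []          []                = [] , refl
  all-i ((.i , d) ∷ r) (_ ∷ ps)   (here refl ∷ qs)  with all-i r ps qs
  ... | u , refl = d ∷ u , refl
  all-i (_ ∷ r)       (i≤a ∷ _)  (there a∈is ∷ _)  = ⊥-elim (i≤a (Allᵥ.lookup below a∈is))
  rest = all-i r i≤r r∈
split-row below (a ∷ r) (a≤r ∷ inc) (there a∈is ∷ r∈) with split-row below r inc r∈
... | r⁻ , u , refl , inc⁻ , r⁻∈ = a ∷ r⁻ , u , refl , All.++⁻ˡ r⁻ a≤r ∷ inc⁻ , a∈is ∷ r⁻∈

take-length-++ : ∀ {A : Set} (xs ys : List A) → take (length xs) (xs ++ ys) ≡ xs
take-length-++ []       ys = refl
take-length-++ (x ∷ xs) ys = cong (x ∷_) (take-length-++ xs ys)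

drop-length-++ : ∀ {A : Set} (xs ys : List A) → drop (length xs) (xs ++ ys) ≡ ys
drop-length-++ []       ys = refl
drop-length-++ (x ∷ xs) ys = drop-length-++ xs ys

firstRow-letters : ∀ {N n m} {is : Vec (Fin N) m} (T : Filling N n) → TableauOver is T →
                   All (λ a → proj₁ a ∈ᵥ is) (firstRow T)
firstRow-letters []      _                   = []
firstRow-letters (_ ∷ _) (_ , _ , r∈is , _) = r∈is

firstRow-empty : ∀ {N n m} {is : Vec (Fin N) m} (T : Filling N n) → TableauOver is T →
                 length (firstRow T) ≤ 0 → T ≡ []
firstRow-empty []      _         _   = refl
firstRow-empty (_ ∷ _) (0<r , _) r≤0 = ⊥-elim (<⇒≱ 0<r r≤0)

addStrip-surjective : ∀ {N n m} {i : Fin N} {is : Vec (Fin N) m} → Below i is →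
  (T : Filling N n) → TableauOver (i ∷ is) T →
  ∃[ T⁻ ] ∃[ w ] (TableauOver is T⁻ × Strippable (rowLengths T) T⁻ w × addStrip i (rowLengths T) T⁻ w ≡ T)
addStrip-surjective below [] _ = [] , [] , tt , ([] , refl) , refl
addStrip-surjective {i = i} below (r ∷ T) (0<r , inc , r∈ , col , tab) with split-row below r inc r∈
... | r⁻ , u , refl , inc⁻ , r⁻∈
  with colStrict-drop r⁻ u (firstRow T) (All.map (not-above below) (firstRow-letters T tab)) col
-- A row made of i alone has nothing under it, so it is the last row and entirely new; it leaves no
-- empty row behind.
addStrip-surjective {i = i} below (r ∷ T) (0<r , inc , r∈ , col , tab)
  | [] , u , refl , inc⁻ , r⁻∈ | _ , T≤0 with firstRow-empty T tab T≤0
... | refl = [] , u , tt , (last 0<r , cong (_+ 0) (sym (length-map (i ,_) u))) , refl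
addStrip-surjective {i = i} below (r ∷ T) (0<r , inc , r∈ , col , tab)
  | r⁻@(_ ∷ _) , u , refl , inc⁻ , r⁻∈ | col⁻ , T≤r⁻ with addStrip-surjective below T tab
... | T⁻ , w , tab⁻ , st@(h , size) , eq =
  r⁻ ∷ T⁻ , u ++ w ,
  (s≤s z≤n , inc⁻ , r⁻∈ , col⁻⁻ , tab⁻) ,
  (cons (s≤s z≤n) (length-++-≤ˡ r⁻) (subst (_≤ length r⁻) (length-firstRow T) T≤r⁻) h , size⁺) ,
  cong₂ _∷_ (cong (λ v → r⁻ ++ map (i ,_) v) (trans (cong (λ d → take d (u ++ w)) d≡) (take-length-++ u w)))
            (trans (cong (addStrip i (rowLengths T) T⁻) (trans (cong (λ d → drop d (u ++ w)) d≡) (drop-length-++ u w))) eq)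
  where
  row≡ : length (r⁻ ++ map (i ,_) u) ≡ length r⁻ + length u
  row≡ = trans (length-++ r⁻) (cong (length r⁻ +_) (length-map (i ,_) u))
  d≡ : length (r⁻ ++ map (i ,_) u) ∸ length r⁻ ≡ length u
  d≡ = trans (cong (_∸ length r⁻) row≡) (m+n∸m≡n (length r⁻) (length u))
  -- The first row of `T⁻` is a prefix of that of `T` and inherits its column condition.
  col⁻⁻ : ColStrict r⁻ (firstRow T⁻)
  col⁻⁻ with firstRow-addStrip i (rowLengths T) T⁻ w st
  ... | v , first≡ = colStrict-prefix (firstRow T⁻)
                       (subst (ColStrict r⁻) (trans (cong firstRow (sym eq)) first≡) col⁻)
  size⁺ : length (u ++ w) + (length r⁻ + sum (rowLengths T⁻)) ≡ length (r⁻ ++ map (i ,_) u) + sum (rowLengths T)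
  size⁺ = begin
    length (u ++ w) + (length r⁻ + sum (rowLengths T⁻))
      ≡⟨ cong (_+ (length r⁻ + sum (rowLengths T⁻))) (length-++ u) ⟩
    length u + length w + (length r⁻ + sum (rowLengths T⁻))
      ≡⟨ solve 4 (λ a b c d → a :+ b :+ (c :+ d) := c :+ a :+ (b :+ d)) refl (length u) (length w) (length r⁻) _ ⟩
    length r⁻ + length u + (length w + sum (rowLengths T⁻))
      ≡⟨ cong₂ _+_ (sym row≡) size ⟩
    length (r⁻ ++ map (i ,_) u) + sum (rowLengths T)  ∎
    where
    open ≡-Reasoning
    open +-*-Solver

split-injective : ∀ {N n} {i : Fin N} (r r′ : List (Letter N n)) u u′ →
  All (λ a → toℕ (proj₁ a) < toℕ i) r → All (λ a → toℕ (proj₁ a) < toℕ i) r′ →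
  r ++ map (i ,_) u ≡ r′ ++ map (i ,_) u′ → r ≡ r′ × u ≡ u′
split-injective []      []       u       u′ _ _ eq =
  refl , map-injective (proj₂ ∘ ,-injective) eq
split-injective []      (_ ∷ _)  (_ ∷ _) u′ _ (a<i ∷ _) eq = ⊥-elim (<-irrefl (cong (toℕ ∘ proj₁) (sym (∷-injectiveˡ eq))) a<i)
split-injective (_ ∷ _) []       u (_ ∷ _) (a<i ∷ _) _ eq = ⊥-elim (<-irrefl (cong (toℕ ∘ proj₁) (∷-injectiveˡ eq)) a<i)
split-injective (_ ∷ r) (_ ∷ r′) u u′ (_ ∷ p) (_ ∷ p′) eq with ∷-injective eq
... | refl , eq′ with split-injective r r′ u u′ p p′ eq′
... | refl , refl = refl , refl

-- Once the shape is fixed, each row shows where index i begins, hence the old row and the colours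
-- dealt to it. If only one of the fillings had a row there, that row would be empty; and a strip
-- never opens two new rows.
addStrip-injective′ : ∀ {N n m} {i : Fin N} {is : Vec (Fin N) m} → Below i is →
  ∀ lam (T T′ : Filling N n) w w′ → TableauOver is T → TableauOver is T′ →
  Strippable lam T w → Strippable lam T′ w′ →
  addStrip i lam T w ≡ addStrip i lam T′ w′ → T ≡ T′ × w ≡ w′
addStrip-injective′ below [] [] [] [] [] _ _ _ _ _ = refl , refl
addStrip-injective′ below (l ∷ []) [] [] w w′ _ _ _ _ eq =
  refl , proj₂ (split-injective [] [] w w′ [] [] (∷-injectiveˡ eq))
addStrip-injective′ below (l ∷ []) [] (r ∷ T) w w′ _ (0<r , _ , r∈ , _) _ _ eq
  with split-injective [] r w _ [] (below-row below r∈) (∷-injectiveˡ eq)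
addStrip-injective′ below (l ∷ []) [] (.[] ∷ T) w w′ _ (() , _) _ _ eq | refl , _
addStrip-injective′ below (l ∷ []) (r ∷ T) [] w w′ (0<r , _ , r∈ , _) _ _ _ eq
  with split-injective r [] _ w′ (below-row below r∈) [] (∷-injectiveˡ eq)
addStrip-injective′ below (l ∷ []) (.[] ∷ T) [] w w′ (() , _) _ _ _ eq | refl , _
addStrip-injective′ below (l ∷ lam) (r ∷ T) (r′ ∷ T′) w w′
  (_ , _ , r∈ , _ , tab) (_ , _ , r′∈ , _ , tab′) st st′ eq
  with split-injective r r′ _ _ (below-row below r∈) (below-row below r′∈) (∷-injectiveˡ eq)
... | refl , taken≡
  with addStrip-injective′ below lam T T′ _ _ tab tab′
         (proj₂ (proj₂ (strippable-tail {r = r} {T} {w} st)))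
         (proj₂ (proj₂ (strippable-tail {r = r} {T′} {w′} st′))) (∷-injectiveʳ eq)
... | refl , dropped≡ = refl , (begin
  w                    ≡⟨ take++drop≡id d w ⟨
  take d w ++ drop d w ≡⟨ cong₂ _++_ taken≡ dropped≡ ⟩
  take d w′ ++ drop d w′ ≡⟨ take++drop≡id d w′ ⟩
  w′                   ∎)
  where
  d = l ∸ length r
  open ≡-Reasoning
addStrip-injective′ below (l ∷ l′ ∷ lam) [] _ w w′ _ _ (() , _) _ _
addStrip-injective′ below (l ∷ l′ ∷ lam) (_ ∷ _) [] w w′ _ _ _ (() , _) _

addStrip-injective : ∀ {N n m} {i : Fin N} {is : Vec (Fin N) m} → Below i is →
  ∀ lam lam′ (T T′ : Filling N n) w w′ → TableauOver is T → TableauOver is T′ →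
  Strippable lam T w → Strippable lam′ T′ w′ →
  addStrip i lam T w ≡ addStrip i lam′ T′ w′ → lam ≡ lam′ × T ≡ T′ × w ≡ w′
addStrip-injective {i = i} below lam lam′ T T′ w w′ tab tab′ st st′ eq
  with trans (sym (rowLengths-addStrip i lam T w st)) (trans (cong rowLengths eq) (rowLengths-addStrip i lam′ T′ w′ st′))
... | refl = refl , addStrip-injective′ below lam T T′ w w′ tab tab′ st st′ eq

addStrip-count : ∀ {N n} {P : Letter N n → Set} (P? : ∀ a → Dec (P a)) (i : Fin N) lam (T : Filling N n) w →
  Strippable lam T w →
  countP P? (entries (addStrip i lam T w)) ≡ countP P? (entries T) + countP (P? ∘ (i ,_)) w
addStrip-count P? i []        []      []      _ = refl
addStrip-count P? i (l ∷ lam) []      w       _ =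
  trans (cong (countP P?) (++-identityʳ (map (i ,_) w))) (countP-map P? (i ,_) w)
addStrip-count P? i (l ∷ lam) (r ∷ T) w       st = begin
  # ((r ++ map (i ,_) u) ++ entries S)           ≡⟨ countP-++ P? (r ++ map (i ,_) u) _ ⟩
  # (r ++ map (i ,_) u) + # (entries S)          ≡⟨ cong₂ _+_ (countP-++ P? r _)
                                                      (addStrip-count P? i lam T v (proj₂ (proj₂ (strippable-tail {r = r} {T} {w} st)))) ⟩
  # r + # (map (i ,_) u) + (# (entries T) + #ᵢ v) ≡⟨ cong (λ x → # r + x + (# (entries T) + #ᵢ v)) (countP-map P? (i ,_) u) ⟩
  # r + #ᵢ u + (# (entries T) + #ᵢ v)             ≡⟨ solve 4 (λ a b c d → a :+ b :+ (c :+ d) := a :+ c :+ (b :+ d)) refl (# r) (#ᵢ u) (# (entries T)) (#ᵢ v) ⟩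
  # r + # (entries T) + (#ᵢ u + #ᵢ v)             ≡⟨ cong₂ _+_ (countP-++ P? r _) (countP-++ (P? ∘ (i ,_)) u v) ⟨
  # (r ++ entries T) + #ᵢ (u ++ v)                ≡⟨ cong (λ x → # (r ++ entries T) + #ᵢ x) (take++drop≡id (l ∸ length r) w) ⟩
  # (r ++ entries T) + #ᵢ w                       ∎
  where
  # = countP P?
  #ᵢ = countP (P? ∘ (i ,_))
  u = take (l ∸ length r) w
  v = drop (l ∸ length r) w
  S = addStrip i lam T v
  open ≡-Reasoning
  open +-*-Solver

-- Chains against tableaux

build : ∀ {N n m} → Vec (Fin N) m → Chain (Fin n) m → Filling N n
build []       []              = []
build (i ∷ is) ((lam , w) ∷ c) = addStrip i lam (build is c) w

strippable : ∀ {N n m} {T : Filling N n} {c : Chain (Fin n) m} {lam w} → rowLengths T ≡ shape c →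
             Valid ((lam , w) ∷ c) → Strippable lam T w
strippable sh (h , size , _) rewrite sh = h , size

build-tableau : ∀ {N n m} (is : Vec (Fin N) m) → Decreasing is → (c : Chain (Fin n) m) → Valid c →
                TableauOver is (build is c) × rowLengths (build is c) ≡ shape c
build-tableau []       _             []              _ = tt , refl
build-tableau (i ∷ is) (below ∷ dec) ((lam , w) ∷ c) v@(_ , _ , vc) with build-tableau is dec c vc
... | tab , sh =
  addStrip-tableau below lam _ w tab st , rowLengths-addStrip i lam _ w st
  where
  st = strippable {w = w} sh v

build-strippable : ∀ {N n m} (is : Vec (Fin N) m) → Decreasing is → ∀ {lam w} (c : Chain (Fin n) m) →
                   Valid ((lam , w) ∷ c) → Strippable lam (build is c) w
build-strippable is dec {w = w} c v@(_ , _ , vc) = strippable {w = w} (proj₂ (build-tableau is dec c vc)) v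

build-surjective : ∀ {N n m} (is : Vec (Fin N) m) → Decreasing is → (T : Filling N n) → TableauOver is T →
                   ∃[ c ] (Valid c × build is c ≡ T)
build-surjective []       _ []            _ = [] , tt , refl
build-surjective []       _ ((_ ∷ _) ∷ _) (_ , _ , () ∷ _ , _)
build-surjective (i ∷ is) (below ∷ dec) T tab with addStrip-surjective below T tab
... | T⁻ , w , tab⁻ , (h , size) , eq with build-surjective is dec T⁻ tab⁻
... | c , v , refl with rowLengths (build is c) | proj₂ (build-tableau is dec c v)
... | _ | refl = (rowLengths T , w) ∷ c , (h , size , v) , eq

build-injective : ∀ {N n m} (is : Vec (Fin N) m) → Decreasing is → (c c′ : Chain (Fin n) m) →
                  Valid c → Valid c′ → build is c ≡ build is c′ → c ≡ c′
build-injective []       _             []              []                _ _ _ = refl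
build-injective (i ∷ is) (below ∷ dec) ((lam , w) ∷ c) ((lam′ , w′) ∷ c′) v@(_ , _ , vc) v′@(_ , _ , vc′) eq
  with addStrip-injective below lam lam′ (build is c) (build is c′) w w′
         (proj₁ (build-tableau is dec c vc)) (proj₁ (build-tableau is dec c′ vc′))
         (build-strippable is dec {w = w} c v) (build-strippable is dec {w = w′} c′ v′) eq
... | refl , T≡ , refl = cong (_ ∷_) (build-injective is dec c c′ vc vc′ T≡)

countP-none : ∀ {A : Set} {P : A → Set} (P? : ∀ a → Dec (P a)) {xs} → All (¬_ ∘ P) xs → countP P? xs ≡ 0
countP-none P? none = cong length (filter-none P? none)

countP-cong : ∀ {A : Set} {P Q : A → Set} (P? : ∀ a → Dec (P a)) (Q? : ∀ a → Dec (Q a)) →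
              (∀ a → does (P? a) ≡ does (Q? a)) → ∀ xs → countP P? xs ≡ countP Q? xs
countP-cong P? Q? eq []       = refl
countP-cong P? Q? eq (x ∷ xs) with does (P? x) | does (Q? x) | eq x
... | true  | _ | refl = cong suc (countP-cong P? Q? eq xs)
... | false | _ | refl = countP-cong P? Q? eq xs

entries-letters : ∀ {N n m} {is : Vec (Fin N) m} (T : Filling N n) → TableauOver is T →
                  All (λ a → proj₁ a ∈ᵥ is) (entries T)
entries-letters []      _                         = []
entries-letters (_ ∷ T) (_ , _ , r∈ , _ , tab) = All.++⁺ r∈ (entries-letters T tab)

-- Decreasing indices are distinct, so the letters of index `lookup is p` all lie in one strip, the
-- one whose colours are the word at p.
build-letterCount : ∀ {N n m} (is : Vec (Fin N) m) → Decreasing is → (c : Chain (Fin n) m) → Valid c → ∀ p k →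
                    letterCount (lookup is p , k) (build is c) ≡ countP (_≟ k) (wordAt c p)
build-letterCount (i ∷ is) (below ∷ dec) ((lam , w) ∷ c) v@(_ , _ , vc) p k =
  trans (addStrip-count (_≟L (lookup (i ∷ is) p , k)) i lam (build is c) w (build-strippable is dec {w = w} c v)) (cases p)
  where
  tab = proj₁ (build-tableau is dec c vc)
  same : ∀ d → does ((i , d) ≟L (i , k)) ≡ does (d ≟ k)
  same d with (i , d) ≟L (i , k) | d ≟ k
  ... | yes _ | yes _ = refl
  ... | no _  | no _  = refl
  ... | yes e | no ¬e = ⊥-elim (¬e (cong proj₂ e))
  ... | no ¬e | yes e = ⊥-elim (¬e (cong (i ,_) e))
  cases : ∀ p → countP (_≟L (lookup (i ∷ is) p , k)) (entries (build is c)) +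
                countP ((_≟L (lookup (i ∷ is) p , k)) ∘ (i ,_)) w ≡ countP (_≟ k) (wordAt ((lam , w) ∷ c) p)
  cases zero = cong₂ _+_
    (countP-none (_≟L (i , k)) (All.map (λ { j∈ refl → <-irrefl refl (Allᵥ.lookup below j∈) }) (entries-letters (build is c) tab)))
    (countP-cong ((_≟L (i , k)) ∘ (i ,_)) (_≟ k) same w)
  cases (suc p) = trans (cong₂ _+_
    (build-letterCount is dec c vc p k)
    (countP-none ((_≟L (lookup is p , k)) ∘ (i ,_)) (All.universal (λ d e → <-irrefl (sym (cong (toℕ ∘ proj₁) e)) (Allᵥ.lookup below (∈ᵥ-lookup p is))) w)))
    (+-identityʳ _)

-- Finite sums

ΣFin-cong : ∀ {N} {f g : Fin N → ℕ} → (∀ i → f i ≡ g i) → ΣFin N f ≡ ΣFin N g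
ΣFin-cong {N} eq = cong sum (map-cong eq (allFin N))

ΣFin-mono : ∀ {N} {f g : Fin N → ℕ} → (∀ i → f i ≤ g i) → ΣFin N f ≤ ΣFin N g
ΣFin-mono {zero}                  _  = z≤n
ΣFin-mono {suc N} {f} {g} f≤g = begin
  ΣFin (suc N) f               ≡⟨ ΣFin-suc f ⟩
  f zero + ΣFin N (f ∘ suc)    ≤⟨ +-mono-≤ (f≤g zero) (ΣFin-mono (f≤g ∘ suc)) ⟩
  g zero + ΣFin N (g ∘ suc)    ≡⟨ ΣFin-suc g ⟨
  ΣFin (suc N) g               ∎
  where open ≤-Reasoning

≤-ΣFin : ∀ {N} (f : Fin N → ℕ) i → f i ≤ ΣFin N f
≤-ΣFin {suc N} f zero    = subst (f zero ≤_) (sym (ΣFin-suc f)) (m≤m+n (f zero) _)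
≤-ΣFin {suc N} f (suc i) =
  subst (f (suc i) ≤_) (sym (ΣFin-suc f)) (≤-trans (≤-ΣFin (f ∘ suc) i) (m≤n+m _ (f zero)))

unique-↭ : ∀ {A : Set} {xs ys : List A} → Unique xs → Unique ys →
           (∀ {x} → x ∈ xs → x ∈ ys) → (∀ {x} → x ∈ ys → x ∈ xs) → xs ↭ ys
unique-↭ xs! ys! to from = ∼bag⇒↭ (unique∧set⇒bag xs! ys! (mk⇔ to from))

opposite-injective : ∀ {N} {i j : Fin N} → opposite i ≡ opposite j → i ≡ j
opposite-injective {i = i} {j} eq =
  trans (sym (opposite-involutive i)) (trans (cong opposite eq) (opposite-involutive j))

ΣFin-opposite : ∀ {N} (f : Fin N → ℕ) → ΣFin N (f ∘ opposite) ≡ ΣFin N f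
ΣFin-opposite {N} f = trans (cong sum (map-∘ (allFin N))) (sum-↭ (↭-map⁺ f reversed))
  where
  reversed : map opposite (allFin N) ↭ allFin N
  reversed = unique-↭ (Unique.map⁺ opposite-injective (Unique.allFin⁺ N)) (Unique.allFin⁺ N)
    (λ {x} _ → ∈-allFin x)
    (λ {x} _ → subst (_∈ map opposite (allFin N)) (opposite-involutive x) (∈-map⁺ opposite (∈-allFin (opposite x))))

-- Enumerations without repetition

concatMap-unique : ∀ {A B : Set} {xs : List A} {g : A → List B} → Unique xs → (∀ a → Unique (g a)) →
                   (∀ {a a′ b} → b ∈ g a → b ∈ g a′ → a ≡ a′) → Unique (concatMap g xs)
concatMap-unique {xs = []}     []          _  _   = []
concatMap-unique {xs = x ∷ xs} {g} (x∉ ∷ xs!) g! sep =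
  Unique.++⁺ (g! x) (concatMap-unique xs! g! sep) disjoint
  where
  disjoint : ∀ {b} → ¬ (b ∈ g x × b ∈ concatMap g xs)
  disjoint (b∈x , b∈xs) with find (∈-concatMap⁻ g {xs = xs} b∈xs)
  ... | a , a∈ , b∈a = All.lookup x∉ a∈ (sep b∈x b∈a)

-- The common form to which `wordsOver`, `allVecs`, `weakComps` and `fillings` unfold at a successor
-- or a non-empty shape; absence of repetitions and membership are thus treated once.
graft : {A B C : Set} → (A → B → C) → List A → (A → List B) → List C
graft h xs g = concatMap (λ a → map (h a) (g a)) xs

Injective₂ : {A B C : Set} → (A → B → C) → Set
Injective₂ h = ∀ {a a′ b b′} → h a b ≡ h a′ b′ → a ≡ a′ × b ≡ b′

graft-unique : ∀ {A B C : Set} {h : A → B → C} {xs g} → Injective₂ h → Unique xs → (∀ a → Unique (g a)) →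
               Unique (graft h xs g)
graft-unique {h = h} inj xs! g! = concatMap-unique xs! (λ a → Unique.map⁺ (proj₂ ∘ inj) (g! a)) sep
  where
  sep : ∀ {a a′ c} → c ∈ map (h a) _ → c ∈ map (h a′) _ → a ≡ a′
  sep {a} {a′} p q with ∈-map⁻ (h a) p | ∈-map⁻ (h a′) q
  ... | _ , _ , refl | _ , _ , eq = proj₁ (inj eq)

∈-graft⁺ : ∀ {A B C : Set} (h : A → B → C) {xs} g {a b} → a ∈ xs → b ∈ g a → h a b ∈ graft h xs g
∈-graft⁺ h g {a} a∈ b∈ = ∈-concatMap⁺ (λ a → map (h a) (g a)) (lose a∈ (∈-map⁺ (h a) b∈))

graft-elim : ∀ {A B C : Set} (h : A → B → C) xs g (P : C → Set) →
             (∀ {a b} → a ∈ xs → b ∈ g a → P (h a b)) → ∀ {c} → c ∈ graft h xs g → P c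
graft-elim h xs g P step c∈ with find (∈-concatMap⁻ (λ a → map (h a) (g a)) {xs = xs} c∈)
... | a , a∈ , c∈a with ∈-map⁻ (h a) c∈a
... | b , b∈ , refl = step a∈ b∈

length-graft : ∀ {A B C : Set} (h : A → B → C) xs g → length (graft h xs g) ≡ sum (map (length ∘ g) xs)
length-graft h []       g = refl
length-graft h (x ∷ xs) g =
  trans (length-++ (map (h x) (g x))) (cong₂ _+_ (length-map (h x) (g x)) (length-graft h xs g))

wordsOver-unique : ∀ {A : Set} {xs : List A} → Unique xs → ∀ ℓ → Unique (wordsOver xs ℓ)
wordsOver-unique xs! zero    = [] ∷ []
wordsOver-unique xs! (suc ℓ) = graft-unique ∷-injective xs! (λ _ → wordsOver-unique xs! ℓ)

∈-wordsOver⁺ : ∀ {A : Set} {xs : List A} {w} → All (_∈ xs) w → w ∈ wordsOver xs (length w)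
∈-wordsOver⁺ []         = here refl
∈-wordsOver⁺ (x∈ ∷ w∈) = ∈-graft⁺ _∷_ _ x∈ (∈-wordsOver⁺ w∈)

∈-wordsOver⁻ : ∀ {A : Set} {xs : List A} ℓ {w} → w ∈ wordsOver xs ℓ → length w ≡ ℓ
∈-wordsOver⁻ zero    (here refl) = refl
∈-wordsOver⁻ {xs = xs} (suc ℓ) =
  graft-elim _∷_ xs (λ _ → wordsOver xs ℓ) (λ w → length w ≡ suc ℓ) (λ _ → cong suc ∘ ∈-wordsOver⁻ ℓ)

wordsUpTo-unique : ∀ {A : Set} {xs : List A} → Unique xs → ∀ D → Unique (wordsUpTo xs D)
wordsUpTo-unique xs! D = concatMap-unique (Unique.upTo⁺ (suc D)) (wordsOver-unique xs!)
  (λ p q → trans (sym (∈-wordsOver⁻ _ p)) (∈-wordsOver⁻ _ q))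

∈-wordsUpTo⁺ : ∀ {A : Set} {xs : List A} {D w} → All (_∈ xs) w → length w ≤ D → w ∈ wordsUpTo xs D
∈-wordsUpTo⁺ {xs = xs} w∈ w≤D = ∈-concatMap⁺ (wordsOver xs) (lose (∈-upTo⁺ (s≤s w≤D)) (∈-wordsOver⁺ w∈))

allVecs-unique : ∀ {A : Set} {xs : List A} → Unique xs → ∀ k → Unique (allVecs xs k)
allVecs-unique xs! zero    = [] ∷ []
allVecs-unique xs! (suc k) = graft-unique ∷ᵥ-injective xs! (λ _ → allVecs-unique xs! k)

∈-allVecs⁺ : ∀ {A : Set} {xs : List A} {k} (v : Vec A k) → (∀ i → lookup v i ∈ xs) → v ∈ allVecs xs k
∈-allVecs⁺ []      _  = here refl
∈-allVecs⁺ (x ∷ v) v∈ = ∈-graft⁺ _∷_ _ (v∈ zero) (∈-allVecs⁺ v (v∈ ∘ suc))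

weakComps-unique : ∀ n m → Unique (weakComps n m)
weakComps-unique zero    zero    = [] ∷ []
weakComps-unique zero    (suc m) = []
weakComps-unique (suc n) m       =
  graft-unique ∷ᵥ-injective (Unique.upTo⁺ (suc m)) (λ j → weakComps-unique n (m ∸ j))

∈-weakComps⁺ : ∀ {n m} (f : Fin n → ℕ) → ΣFin n f ≡ m → tabulate f ∈ weakComps n m
∈-weakComps⁺ {zero}      f refl = here refl
∈-weakComps⁺ {suc n} {m} f eq   =
  ∈-graft⁺ _∷_ _ (∈-upTo⁺ (s≤s f0≤)) (∈-weakComps⁺ (f ∘ suc) rest)
  where
  split : f zero + ΣFin n (f ∘ suc) ≡ m
  split = trans (sym (ΣFin-suc f)) eq
  f0≤ : f zero ≤ m
  f0≤ = subst (f zero ≤_) split (m≤m+n (f zero) _)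
  rest : ΣFin n (f ∘ suc) ≡ m ∸ f zero
  rest = trans (sym (m+n∸m≡n (f zero) _)) (cong (_∸ f zero) split)

letters-unique : ∀ N n → Unique (letters N n)
letters-unique N n = Unique.cartesianProduct⁺ (Unique.allFin⁺ N) (Unique.allFin⁺ n)

fillings-unique : ∀ N n lam → Unique (fillings N n lam)
fillings-unique N n []        = [] ∷ []
fillings-unique N n (r ∷ lam) =
  graft-unique ∷-injective (wordsOver-unique (letters-unique N n) r) (λ _ → fillings-unique N n lam)

∈-fillings⁺ : ∀ {N n} (T : Filling N n) → T ∈ fillings N n (rowLengths T)
∈-fillings⁺ []      = here refl
∈-fillings⁺ (r ∷ T) = ∈-graft⁺ _∷_ _
  (∈-wordsOver⁺ (All.universal (λ a → ∈-cartesianProduct⁺ (∈-allFin (proj₁ a)) (∈-allFin (proj₂ a))) r))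
  (∈-fillings⁺ T)

partitions-unique : ∀ m → Unique (partitions m)
partitions-unique m = Unique.filter⁺ (isPartitionOf? m) (wordsUpTo-unique (Unique.upTo⁺ (suc m)) m)

∈-partitions⁺ : ∀ {m lam} → IsPartitionOf m lam → lam ∈ partitions m
∈-partitions⁺ {m} {lam} p@(_ , pos , refl) =
  ∈-filter⁺ (isPartitionOf? m) (∈-wordsUpTo⁺ (All.map (∈-upTo⁺ ∘ s≤s) (parts≤sum lam)) (length≤sum lam pos)) p
  where
  parts≤sum : ∀ xs → All (_≤ sum xs) xs
  parts≤sum []       = []
  parts≤sum (x ∷ xs) = m≤m+n x _ ∷ All.map (λ y≤ → ≤-trans y≤ (m≤n+m _ x)) (parts≤sum xs)
  length≤sum : ∀ xs → All (0 <_) xs → length xs ≤ sum xs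
  length≤sum []       _        = z≤n
  length≤sum (x ∷ xs) (p ∷ ps) = +-mono-≤ p (length≤sum xs ps)

-- The image of `ys` has no repetitions and the same elements as `xs`, hence is a permutation of it;
-- this turns a bijection into an equality of counts.
length-≡-via : ∀ {A B : Set} {xs : List A} {ys : List B} (f : B → A) → Unique xs → Unique ys →
               (∀ {y y′} → f y ≡ f y′ → y ≡ y′) → (∀ {y} → y ∈ ys → f y ∈ xs) →
               (∀ {x} → x ∈ xs → ∃[ y ] (y ∈ ys × f y ≡ x)) → length xs ≡ length ys
length-≡-via {xs = xs} {ys} f xs! ys! inj into onto =
  trans (↭-length (unique-↭ xs! (Unique.map⁺ inj ys!) to from)) (length-map f ys)
  where
  to : ∀ {x} → x ∈ xs → x ∈ map f ys
  to x∈ with onto x∈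
  ... | y , y∈ , refl = ∈-map⁺ f y∈
  from : ∀ {x} → x ∈ map f ys → x ∈ xs
  from x∈ with ∈-map⁻ f x∈
  ... | y , y∈ , refl = into y∈

-- Counting by fibres

-- Written with `filter` so that it reduces on the same Boolean as `countP`.
indicator : ∀ {P : Set} → Dec P → ℕ
indicator P? = length (filter (λ _ → P?) (tt ∷ []))

countP-∷ : ∀ {A : Set} {P : A → Set} (P? : ∀ a → Dec (P a)) x xs →
           countP P? (x ∷ xs) ≡ indicator (P? x) + countP P? xs
countP-∷ P? x xs with does (P? x)
... | true  = refl
... | false = refl

ΣFin-+ : ∀ {N} (f g : Fin N → ℕ) → ΣFin N (λ i → f i + g i) ≡ ΣFin N f + ΣFin N g
ΣFin-+ {zero}  f g = refl
ΣFin-+ {suc N} f g = begin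
  ΣFin (suc N) (λ i → f i + g i)                                   ≡⟨ ΣFin-suc (λ i → f i + g i) ⟩
  f zero + g zero + ΣFin N (λ i → f (suc i) + g (suc i))           ≡⟨ cong (f zero + g zero +_) (ΣFin-+ (f ∘ suc) (g ∘ suc)) ⟩
  f zero + g zero + (ΣFin N (f ∘ suc) + ΣFin N (g ∘ suc))          ≡⟨ solve 4 (λ a b c d → a :+ b :+ (c :+ d) := a :+ c :+ (b :+ d)) refl (f zero) (g zero) _ _ ⟩
  f zero + ΣFin N (f ∘ suc) + (g zero + ΣFin N (g ∘ suc))          ≡⟨ cong₂ _+_ (ΣFin-suc f) (ΣFin-suc g) ⟨
  ΣFin (suc N) f + ΣFin (suc N) g                                  ∎
  where
  open ≡-Reasoning
  open +-*-Solver

ΣFin-zero : ∀ N → ΣFin N (λ _ → 0) ≡ 0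
ΣFin-zero zero    = refl
ΣFin-zero (suc N) = trans (ΣFin-suc {N} (λ _ → 0)) (ΣFin-zero N)

indicator-yes : ∀ {P : Set} (P? : Dec P) → P → indicator P? ≡ 1
indicator-yes (yes _) _ = refl
indicator-yes (no ¬p) p = ⊥-elim (¬p p)

indicator-no : ∀ {P : Set} (P? : Dec P) → ¬ P → indicator P? ≡ 0
indicator-no (yes p) ¬p = ⊥-elim (¬p p)
indicator-no (no _)  _  = refl

ΣFin-indicator : ∀ {n} (j : Fin n) {Q : Fin n → Set} (Q? : ∀ k → Dec (Q k)) →
                 (∀ k → Q k → j ≡ k) → Q j → ΣFin n (indicator ∘ Q?) ≡ 1
ΣFin-indicator {suc n} zero Q? only q =
  trans (ΣFin-suc (indicator ∘ Q?)) (cong₂ _+_ (indicator-yes (Q? zero) q)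
    (trans (ΣFin-cong (λ k → indicator-no (Q? (suc k)) (Fin.0≢1+n ∘ only (suc k)))) (ΣFin-zero n)))
ΣFin-indicator {suc n} (suc j) Q? only q =
  trans (ΣFin-suc (indicator ∘ Q?)) (cong₂ _+_ (indicator-no (Q? zero) (Fin.0≢1+n ∘ sym ∘ only zero))
    (ΣFin-indicator j (Q? ∘ suc) (λ k → Fin.suc-injective ∘ only (suc k)) q))

-- `Q k` cuts P down to the fibre of `f` over k: at an element satisfying P exactly one k
-- contributes, at any other none.
countP-fibres : ∀ {A : Set} {n} {P : A → Set} {Q : Fin n → A → Set}
  (P? : ∀ a → Dec (P a)) (f : A → Fin n) (Q? : ∀ k a → Dec (Q k a)) →
  (∀ k a → Q k a → P a × f a ≡ k) → (∀ a → P a → Q (f a) a) →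
  ∀ xs → ΣFin n (λ k → countP (Q? k) xs) ≡ countP P? xs
countP-fibres {n = n} P? f Q? Q⇒ ⇒Q []       = ΣFin-zero n
countP-fibres {n = n} P? f Q? Q⇒ ⇒Q (x ∷ xs) = begin
  ΣFin n (λ k → countP (Q? k) (x ∷ xs))                           ≡⟨ ΣFin-cong (λ k → countP-∷ (Q? k) x xs) ⟩
  ΣFin n (λ k → indicator (Q? k x) + countP (Q? k) xs)            ≡⟨ ΣFin-+ (λ k → indicator (Q? k x)) (λ k → countP (Q? k) xs) ⟩
  ΣFin n (λ k → indicator (Q? k x)) + ΣFin n (λ k → countP (Q? k) xs)
    ≡⟨ cong₂ _+_ head≡ (countP-fibres P? f Q? Q⇒ ⇒Q xs) ⟩
  indicator (P? x) + countP P? xs                                 ≡⟨ countP-∷ P? x xs ⟨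
  countP P? (x ∷ xs)                                              ∎
  where
  open ≡-Reasoning
  head≡ : ΣFin n (λ k → indicator (Q? k x)) ≡ indicator (P? x)
  head≡ with P? x
  ... | yes p = ΣFin-indicator (f x) (λ k → Q? k x) (λ k → proj₂ ∘ Q⇒ k x) (⇒Q x p)
  ... | no ¬p = trans (ΣFin-cong (λ k → indicator-no (Q? k x) (¬p ∘ proj₁ ∘ Q⇒ k x))) (ΣFin-zero n)

length-fibres : ∀ {A : Set} {n} (f : A → Fin n) xs → ΣFin n (λ k → countP (λ a → f a ≟ k) xs) ≡ length xs
length-fibres f xs = trans
  (countP-fibres {P = λ _ → ⊤} (λ _ → yes tt) f (λ k a → f a ≟ k) (λ _ _ p → tt , p) (λ _ _ → refl) xs)
  (cong length (filter-all {P = λ _ → ⊤} (λ _ → yes tt) (All.universal (λ _ → tt) xs)))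

length-entries : ∀ {N n} (T : Filling N n) → length (entries T) ≡ sum (rowLengths T)
length-entries []      = refl
length-entries (r ∷ T) = trans (length-++ r) (cong (length r +_) (length-entries T))

-- Summing the letter counts over colours and then over indices meets every cell once. It places the
-- shape among the partitions of `degree α`.
degree-letterCount : ∀ {N n} {α : Fin N → Fin n → ℕ} (T : Filling N n) →
                     (∀ i k → letterCount (i , k) T ≡ α i k) → sum (rowLengths T) ≡ degree α
degree-letterCount {N} {n} {α} T content = begin
  sum (rowLengths T)                                     ≡⟨ length-entries T ⟨
  length (entries T)                                     ≡⟨ length-fibres proj₁ (entries T) ⟨
  ΣFin N (λ i → countP (λ a → proj₁ a ≟ i) (entries T))  ≡⟨ ΣFin-cong (λ i → sym (rows i)) ⟩
  ΣFin N (λ i → ΣFin n (λ k → letterCount (i , k) T))    ≡⟨ ΣFin-cong (λ i → ΣFin-cong (content i)) ⟩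
  degree α                                               ∎
  where
  open ≡-Reasoning
  rows : ∀ i → ΣFin n (λ k → letterCount (i , k) T) ≡ countP (λ a → proj₁ a ≟ i) (entries T)
  rows i = countP-fibres (λ a → proj₁ a ≟ i) proj₂ (λ k a → a ≟L (i , k))
    (λ k a eq → ,-injective eq) (λ { a refl → refl }) (entries T)

-- Each colour in one word adds to an x-exponent of row i, and these total at most `degree α`; the
-- length bound in `wordFamilies` therefore loses no family.
entry-length≤ : ∀ {N n} (α : Fin N → Fin n → ℕ) (W : WordFamily N n) → (∀ i k → xExp W i k ≡ α i k) →
                ∀ i j → length (entry W i j) ≤ degree α
entry-length≤ {N} {n} α W content i j = begin
  length (entry W i j)                                    ≡⟨ length-fibres proj₁ (entry W i j) ⟨
  ΣFin n (λ k → countP (λ c → proj₁ c ≟ k) (entry W i j)) ≤⟨ ΣFin-mono (λ k → ≤-ΣFin (λ j → countP (λ c → proj₁ c ≟ k) (entry W i j)) j) ⟩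
  ΣFin n (λ k → xExp W i k)                               ≡⟨ ΣFin-cong (content i) ⟩
  ΣFin n (λ k → α i k)                                    ≤⟨ ≤-ΣFin (λ i → ΣFin n (α i)) i ⟩
  degree α                                                ∎
  where open ≤-Reasoning

-- Word families and pairs of tableaux

decreasing-tabulate : ∀ {N m} (f : Fin m → Fin N) → (∀ {p q} → toℕ p < toℕ q → toℕ (f q) < toℕ (f p)) →
                      Decreasing (tabulate f)
decreasing-tabulate {m = zero}  f anti = []
decreasing-tabulate {m = suc m} f anti =
  Allᵥ.tabulate⁺ (λ q → anti (s≤s z≤n)) ∷ decreasing-tabulate (f ∘ suc) (anti ∘ s≤s)

-- Largest index first, the order in which strips are removed.
alphabet : ∀ N → Vec (Fin N) N
alphabet N = tabulate opposite

alphabet-decreasing : ∀ N → Decreasing (alphabet N)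
alphabet-decreasing N = decreasing-tabulate opposite anti
  where
  anti : ∀ {p q : Fin N} → toℕ p < toℕ q → toℕ (opposite q) < toℕ (opposite p)
  anti {p} {q} p<q = subst₂ _<_ (sym (opposite-prop q)) (sym (opposite-prop p)) (∸-monoʳ-< (s≤s p<q) (toℕ<n q))

lookup-alphabet : ∀ {N} (i : Fin N) → lookup (alphabet N) (opposite i) ≡ i
lookup-alphabet i = trans (lookup∘tabulate opposite (opposite i)) (opposite-involutive i)

∈-alphabet : ∀ {N} (i : Fin N) → i ∈ᵥ alphabet N
∈-alphabet {N} i = subst (_∈ᵥ alphabet N) (opposite-involutive i) (∈ᵥ-tabulate⁺ opposite (opposite i))

matrix : ∀ {A : Set} {m m′} → (Fin m′ → Fin m → A) → Vec (Vec A m) m′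
matrix f = tabulate (λ q → tabulate (f q))

lookup-matrix : ∀ {A : Set} {m m′} (f : Fin m′ → Fin m → A) q p → lookup (lookup (matrix f) q) p ≡ f q p
lookup-matrix f q p = trans (cong (λ v → lookup v p) (lookup∘tabulate (λ q → tabulate (f q)) q)) (lookup∘tabulate (f q) p)

matrix-cong : ∀ {A : Set} {m m′} {f : Fin m′ → Fin m → A} (Z : Vec (Vec A m) m′) →
              (∀ q p → f q p ≡ lookup (lookup Z q) p) → matrix f ≡ Z
matrix-cong Z eq = trans
  (tabulate-cong (λ q → trans (tabulate-cong (eq q)) (tabulate∘lookup (lookup Z q)))) (tabulate∘lookup Z)

-- Transposes, and reverses both index sets because chains list the largest letter first.
flipReverse : ∀ {A : Set} {N} → Vec (Vec A N) N → Vec (Vec A N) N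
flipReverse W = matrix (λ q p → lookup (lookup W (opposite p)) (opposite q))

lookup-flipReverse : ∀ {A : Set} {N} (W : Vec (Vec A N) N) q p →
                     lookup (lookup (flipReverse W) q) p ≡ lookup (lookup W (opposite p)) (opposite q)
lookup-flipReverse W = lookup-matrix (λ q p → lookup (lookup W (opposite p)) (opposite q))

flipReverse-involutive : ∀ {A : Set} {N} (W : Vec (Vec A N) N) → flipReverse (flipReverse W) ≡ W
flipReverse-involutive W = matrix-cong W λ i j → trans
  (lookup-flipReverse W (opposite j) (opposite i))
  (cong₂ (λ x y → lookup (lookup W x) y) (opposite-involutive i) (opposite-involutive j))

TableauPair : ∀ {N n} → Filling N n × Filling N n → Set
TableauPair {N} (T , T′) = TableauOver (alphabet N) T × TableauOver (alphabet N) T′ × rowLengths T ≡ rowLengths T′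

toTableaux : ∀ {N n} → WordFamily N n → Filling N n × Filling N n
toTableaux {N} W =
  let (c , c′) = toChains (flipReverse W) in build (alphabet N) c , build (alphabet N) c′

toTableaux-valid : ∀ {N n} (W : WordFamily N n) → TableauPair (toTableaux W)
toTableaux-valid {N} W with toChains (flipReverse W) | toChains-valid (flipReverse W)
... | c , c′ | v , v′ , s≡
  with build-tableau (alphabet N) (alphabet-decreasing N) c v | build-tableau (alphabet N) (alphabet-decreasing N) c′ v′
... | tab , sh | tab′ , sh′ = tab , tab′ , trans sh (trans s≡ (sym sh′))

toTableaux-surjective : ∀ {N n} (T T′ : Filling N n) → TableauPair (T , T′) → ∃[ W ] (toTableaux W ≡ (T , T′))
toTableaux-surjective {N} T T′ (tab , tab′ , sh)
  with build-surjective (alphabet N) (alphabet-decreasing N) T tab | build-surjective (alphabet N) (alphabet-decreasing N) T′ tab′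
... | c , v , refl | c′ , v′ , refl
  with toChains-surjective c c′ (v , v′ , trans (sym (proj₂ (build-tableau (alphabet N) (alphabet-decreasing N) c v)))
         (trans sh (proj₂ (build-tableau (alphabet N) (alphabet-decreasing N) c′ v′))))
... | Z , Z↦ = flipReverse Z ,
  cong (λ (c , c′) → build (alphabet N) c , build (alphabet N) c′)
       (trans (cong toChains (flipReverse-involutive Z)) Z↦)

toTableaux-injective : ∀ {N n} (W W′ : WordFamily N n) → toTableaux W ≡ toTableaux W′ → W ≡ W′
toTableaux-injective {N} W W′ eq = trans (sym (flipReverse-involutive W))
  (trans (cong flipReverse (toChains-injective Z Z′ chains≡)) (flipReverse-involutive W′))
  where
  Z = flipReverse W
  Z′ = flipReverse W′
  build-inj = build-injective (alphabet N) (alphabet-decreasing N)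
  chains≡ : toChains Z ≡ toChains Z′
  chains≡ with ,-injective eq | toChains-valid Z | toChains-valid Z′
  ... | T≡ , T′≡ | v , v′ , _ | u , u′ , _ = cong₂ _,_ (build-inj _ _ v u T≡) (build-inj _ _ v′ u′ T′≡)

-- The words of the first chain collect first components down the columns of the matrix.
-- `flipReverse` turns these columns into the rows of `W`, and reversing the order of summation
-- changes nothing.
toTableaux-xExp : ∀ {N n} (W : WordFamily N n) i k → letterCount (i , k) (proj₁ (toTableaux W)) ≡ xExp W i k
toTableaux-xExp {N} W i k = begin
  letterCount (i , k) T                                      ≡⟨ cong (λ j → letterCount (j , k) T) (lookup-alphabet i) ⟨
  letterCount (lookup (alphabet N) (opposite i) , k) T       ≡⟨ build-letterCount (alphabet N) (alphabet-decreasing N) _ (proj₁ (toChains-valid Z)) (opposite i) k ⟩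
  countP (_≟ k) (wordAt (proj₁ (toChains Z)) (opposite i))   ≡⟨ toChains-count₁ (_≟ k) Z (opposite i) ⟩
  ΣFin N (λ q → # (lookup (lookup Z q) (opposite i)))        ≡⟨ ΣFin-cong {N} (λ q → cong # (lookup-flipReverse W q (opposite i))) ⟩
  ΣFin N (λ q → # (entry W (opposite (opposite i)) (opposite q)))
    ≡⟨ ΣFin-opposite (λ j → # (entry W (opposite (opposite i)) j)) ⟩
  ΣFin N (λ j → # (entry W (opposite (opposite i)) j))       ≡⟨ cong (λ i → xExp W i k) (opposite-involutive i) ⟩
  xExp W i k                                                 ∎
  where
  Z = flipReverse W
  T = proj₁ (toTableaux W)
  # = countP (λ c → proj₁ c ≟ k)
  open ≡-Reasoning

toTableaux-yExp : ∀ {N n} (W : WordFamily N n) j l → letterCount (j , l) (proj₂ (toTableaux W)) ≡ yExp W j l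
toTableaux-yExp {N} W j l = begin
  letterCount (j , l) T                                      ≡⟨ cong (λ i → letterCount (i , l) T) (lookup-alphabet j) ⟨
  letterCount (lookup (alphabet N) (opposite j) , l) T       ≡⟨ build-letterCount (alphabet N) (alphabet-decreasing N) _ (proj₁ (proj₂ (toChains-valid Z))) (opposite j) l ⟩
  countP (_≟ l) (wordAt (proj₂ (toChains Z)) (opposite j))   ≡⟨ toChains-count₂ (_≟ l) Z (opposite j) ⟩
  ΣFin N (λ p → # (lookup (lookup Z (opposite j)) p))        ≡⟨ ΣFin-cong {N} (λ p → cong # (lookup-flipReverse W (opposite j) p)) ⟩
  ΣFin N (λ p → # (entry W (opposite p) (opposite (opposite j))))
    ≡⟨ ΣFin-opposite (λ i → # (entry W i (opposite (opposite j)))) ⟩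
  ΣFin N (λ i → # (entry W i (opposite (opposite j))))       ≡⟨ cong (λ j → yExp W j l) (opposite-involutive j) ⟩
  yExp W j l                                                 ∎
  where
  Z = flipReverse W
  T = proj₂ (toTableaux W)
  # = countP (λ c → proj₂ c ≟ l)
  open ≡-Reasoning

-- The conditions of a dotted tableau against their recursive form

colStrict-length : ∀ {N n} (r s : List (Letter N n)) → ColStrict r s → length s ≤ length r
colStrict-length _       []      _       = z≤n
colStrict-length (_ ∷ r) (_ ∷ s) (_ , p) = s≤s (colStrict-length r s p)

-- `_≤A_` compares indices only and is a total preorder, so comparisons of neighbours extend to
-- whole rows.
≤A-trans : ∀ {N n} {a b c : Letter N n} → a ≤A b → b ≤A c → a ≤A c
≤A-trans a≤b b≤c c<a = <-irrefl refl (<-≤-trans c<a (≤-trans (≮⇒≥ a≤b) (≮⇒≥ b≤c)))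

-- That row lengths decrease weakly comes from the columns: every cell of the lower row has a cell
-- above it.
tableau-⇒ : ∀ {N n m} {is : Vec (Fin N) m} (T : Filling N n) → TableauOver is T →
  All (Linked _≤A_) T × Linked ColStrict T × Linked _≥_ (rowLengths T) × All (0 <_) (rowLengths T)
tableau-⇒ []          _                             = [] , [] , [] , []
tableau-⇒ (r ∷ [])    (0<r , inc , _ , _ , _)       = AllPairs⇒Linked inc ∷ [] , [-] , [-] , 0<r ∷ []
tableau-⇒ (r ∷ s ∷ T) (0<r , inc , _ , col , tab) with tableau-⇒ (s ∷ T) tab
... | rows , cols , dec , pos =
  AllPairs⇒Linked inc ∷ rows , col ∷ cols , colStrict-length r s col ∷ dec , 0<r ∷ pos

tableau-⇐ : ∀ {N n} (T : Filling N n) → All (Linked _≤A_) T → Linked ColStrict T → All (0 <_) (rowLengths T) →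
            TableauOver (alphabet N) T
tableau-⇐ []          _            _            _          = tt
tableau-⇐ (r ∷ [])    (inc ∷ _)    _            (0<r ∷ _)  =
  0<r , Linked⇒AllPairs (λ {a b c} → ≤A-trans {a = a} {b} {c}) inc , All.universal (∈-alphabet ∘ proj₁) r , tt , tt
tableau-⇐ (r ∷ s ∷ T) (inc ∷ rows) (col ∷ cols) (0<r ∷ pos) =
  0<r , Linked⇒AllPairs (λ {a b c} → ≤A-trans {a = a} {b} {c}) inc , All.universal (∈-alphabet ∘ proj₁) r , col , tableau-⇐ (s ∷ T) rows cols pos

-- Comparison of coefficients

colours : ∀ {N n} → Filling N n → Vec ℕ n
colours T = tabulate (λ k → colourCount k T)

Labelled : ℕ → ℕ → Set
Labelled N n = List ℕ × Vec ℕ n × Vec ℕ n × Filling N n × Filling N n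

-- The shape and both multidegrees are functions of the pair. Attaching them keeps the terms of the
-- triple sum apart, so that the sum becomes the length of one list without repetitions.
label : ∀ {N n} → Filling N n × Filling N n → Labelled N n
label (T , T′) = rowLengths T , colours T , colours T′ , T , T′

tableaux : ∀ {N n} → List ℕ → Vec ℕ n → (Fin N → Fin n → ℕ) → List (Filling N n)
tableaux {N} {n} lam v α = filter (isDottedTableau? lam v α) (fillings N n lam)

tableaux-unique : ∀ {N n} lam v (α : Fin N → Fin n → ℕ) → Unique (tableaux lam v α)
tableaux-unique {N} {n} lam v α = Unique.filter⁺ (isDottedTableau? lam v α) (fillings-unique N n lam)

module _ (N n : ℕ) (α β : Fin N → Fin n → ℕ) where

  comps : List (Vec ℕ n)
  comps = weakComps n (degree α)

  pairsOf : List ℕ → Vec ℕ n → Vec ℕ n → List (Filling N n × Filling N n)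
  pairsOf lam v w = cartesianProduct (tableaux lam v α) (tableaux lam w β)

  labelledPairs : List (Labelled N n)
  labelledPairs =
    graft _,_ (partitions (degree α)) λ lam →
    graft _,_ comps λ v →
    graft _,_ comps λ w → pairsOf lam v w

  length-labelledPairs : length labelledPairs ≡ lhsCoeff N n α β
  length-labelledPairs =
    trans (length-graft _,_ (partitions (degree α)) _) (cong sum (map-cong (λ lam →
    trans (length-graft _,_ comps _) (cong sum (map-cong (λ v →
    trans (length-graft _,_ comps _) (cong sum (map-cong (λ w →
    length-cartesianProduct (tableaux lam v α) (tableaux lam w β)) comps))) comps))) (partitions (degree α))))
    where
    length-cartesianProduct : ∀ {A B : Set} (xs : List A) (ys : List B) →
                              length (cartesianProduct xs ys) ≡ length xs * length ys
    length-cartesianProduct []       ys = refl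
    length-cartesianProduct (x ∷ xs) ys = trans (length-++ (map (x ,_) ys))
      (cong₂ _+_ (length-map (x ,_) ys) (length-cartesianProduct xs ys))

  labelledPairs-unique : Unique labelledPairs
  labelledPairs-unique =
    graft-unique ,-injective (partitions-unique (degree α)) λ lam →
    graft-unique ,-injective (weakComps-unique n (degree α)) λ v →
    graft-unique ,-injective (weakComps-unique n (degree α)) λ w →
    Unique.cartesianProduct⁺ (tableaux-unique lam v α) (tableaux-unique lam w β)

  HasContents : Filling N n × Filling N n → Set
  HasContents (T , T′) = (∀ i k → letterCount (i , k) T ≡ α i k) × (∀ j l → letterCount (j , l) T′ ≡ β j l)

  ∈-labelledPairs⁺ : ∀ P → TableauPair P → HasContents P → label P ∈ labelledPairs
  ∈-labelledPairs⁺ (T , T′) (tab , tab′ , sh) (content , content′)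
    with tableau-⇒ T tab | tableau-⇒ T′ tab′
  ... | rows , cols , dec , pos | rows′ , cols′ , _ , _ =
    ∈-graft⁺ _,_ _ (∈-partitions⁺ (dec , pos , size))
    (∈-graft⁺ _,_ _ (comp T size)
    -- Equal shapes give the second tableau the same size, so its multidegree is also a composition
    -- of `degree α`.
    (∈-graft⁺ _,_ _ (comp T′ (trans (cong sum (sym sh)) size))
    (∈-cartesianProduct⁺
      (∈-filter⁺ (isDottedTableau? (rowLengths T) (colours T) α) (∈-fillings⁺ T)
        (refl , rows , cols , (λ k → sym (lookup∘tabulate (λ k → colourCount k T) k)) , content))
      (∈-filter⁺ (isDottedTableau? (rowLengths T) (colours T′) β)
        (subst (λ lam → T′ ∈ fillings N n lam) (sym sh) (∈-fillings⁺ T′))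
        (sym sh , rows′ , cols′ , (λ k → sym (lookup∘tabulate (λ k → colourCount k T′) k)) , content′)))))
    where
    size : sum (rowLengths T) ≡ degree α
    size = degree-letterCount T content
    comp : ∀ S → sum (rowLengths S) ≡ degree α → colours S ∈ comps
    comp S size = ∈-weakComps⁺ (λ k → colourCount k S)
      (trans (length-fibres proj₂ (entries S)) (trans (length-entries S) size))

  Labelling : Labelled N n → Set
  Labelling x = ∃[ P ] (TableauPair P × HasContents P × label P ≡ x)

  -- Positive parts of the shape supply the non-empty rows that `TableauOver` asks for, and the
  -- multidegree conditions identify v and w with the colour vectors.
  labelling : ∀ {lam v w T T′} → All (0 <_) lam → IsDottedTableau lam v α T → IsDottedTableau lam w β T′ →
              Labelling (lam , v , w , T , T′)
  labelling {v = v} {w} {T} {T′} pos (refl , rows , cols , col≡ , content) (sh′ , rows′ , cols′ , col≡′ , content′) =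
    (T , T′) ,
    (tableau-⇐ T rows cols pos , tableau-⇐ T′ rows′ cols′ (subst (All (0 <_)) (sym sh′) pos) , sym sh′) ,
    (content , content′) ,
    cong₂ (λ v w → rowLengths T , v , w , T , T′) (colours≡ T v col≡) (colours≡ T′ w col≡′)
    where
    colours≡ : ∀ S v → (∀ k → colourCount k S ≡ lookup v k) → colours S ≡ v
    colours≡ S v eq = trans (tabulate-cong eq) (tabulate∘lookup v)

  ∈-pairsOf⁻ : ∀ {lam} → All (0 <_) lam → ∀ v w {P} → P ∈ pairsOf lam v w → Labelling (lam , v , w , P)
  ∈-pairsOf⁻ {lam} pos v w {T , T′} P∈ =
    let (T∈ , T′∈) = ∈-cartesianProduct⁻ (tableaux lam v α) (tableaux lam w β) P∈
    in labelling pos (proj₂ (∈-filter⁻ (isDottedTableau? lam v α) {xs = fillings N n lam} T∈))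
                     (proj₂ (∈-filter⁻ (isDottedTableau? lam w β) {xs = fillings N n lam} T′∈))

  ∈-labelledPairs⁻ : ∀ {x} → x ∈ labelledPairs → Labelling x
  ∈-labelledPairs⁻ =
    graft-elim _,_ (partitions (degree α)) _ Labelling λ {lam} lam∈ →
    graft-elim _,_ comps _ (λ x → Labelling (lam , x)) λ {v} _ →
    graft-elim _,_ comps _ (λ x → Labelling (lam , v , x)) λ {w} _ →
    ∈-pairsOf⁻ (proj₁ (proj₂ (proj₂ (∈-filter⁻ (isPartitionOf? (degree α))
      {xs = wordsUpTo (upTo (suc (degree α))) (degree α)} lam∈)))) v w

  families : List (WordFamily N n)
  families = filter (hasMonomial? α β) (wordFamilies N n (degree α))

  pairWords-unique : Unique (wordsUpTo (cartesianProduct (allFin n) (allFin n)) (degree α))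
  pairWords-unique = wordsUpTo-unique (letters-unique n n) (degree α)

  families-unique : Unique families
  families-unique = Unique.filter⁺ (hasMonomial? α β) (allVecs-unique (allVecs-unique pairWords-unique N) N)

  ∈-families⁺ : ∀ {W} → HasMonomial α β W → W ∈ families
  ∈-families⁺ {W} mono = ∈-filter⁺ (hasMonomial? α β)
    (∈-allVecs⁺ W (λ i → ∈-allVecs⁺ (lookup W i) (λ j →
      ∈-wordsUpTo⁺ (All.universal (λ c → ∈-cartesianProduct⁺ (∈-allFin (proj₁ c)) (∈-allFin (proj₂ c))) (entry W i j))
                   (entry-length≤ α W (proj₁ mono) i j)))) mono

  -- A label contains its pair, so `label ∘ toTableaux` is still injective; the exponent lemmas
  -- carry the monomial condition in both directions.
  lhsCoeff≡rhsCoeff : lhsCoeff N n α β ≡ rhsCoeff N n α β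
  lhsCoeff≡rhsCoeff = trans (sym length-labelledPairs)
    (length-≡-via (label ∘ toTableaux) labelledPairs-unique families-unique
      (λ {W} {W′} eq → toTableaux-injective W W′ (cong (λ x → proj₂ (proj₂ (proj₂ x))) eq)) into onto)
    where
    into : ∀ {W} → W ∈ families → label (toTableaux W) ∈ labelledPairs
    into {W} W∈ with ∈-filter⁻ (hasMonomial? α β) {xs = wordFamilies N n (degree α)} W∈
    ... | _ , x≡ , y≡ = ∈-labelledPairs⁺ (toTableaux W) (toTableaux-valid W)
      ((λ i k → trans (toTableaux-xExp W i k) (x≡ i k)) , (λ j l → trans (toTableaux-yExp W j l) (y≡ j l)))
    onto : ∀ {x} → x ∈ labelledPairs → ∃[ W ] (W ∈ families × label (toTableaux W) ≡ x)
    onto x∈ with ∈-labelledPairs⁻ x∈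
    ... | (T , T′) , pair , (content , content′) , refl with toTableaux-surjective T T′ pair
    ... | W , W↦ = W , ∈-families⁺
      ( (λ i k → trans (sym (toTableaux-xExp W i k)) (trans (cong (letterCount (i , k) ∘ proj₁) W↦) (content i k)))
      , (λ j l → trans (sym (toTableaux-yExp W j l)) (trans (cong (letterCount (j , l) ∘ proj₂) W↦) (content′ j l))) ) ,
      cong label W↦

theorem8p2 : (n N : ℕ) (α β : Fin N → Fin n → ℕ) →
    lhsCoeff N n α β ≡ rhsCoeff N n α β
theorem8p2 n N α β = lhsCoeff≡rhsCoeff N n α β
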